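{- Consider the graph orientation problem with arbitrary query costs, and let $1\le\alpha\le2$. Suppose \textsc{Threshold} with parameter $d\in(0,1]$ uses, in step 4, an algorithm that always returns a vertex cover of weight at most $\alpha$ times the minimum weight of a vertex cover of $G[V_{1/2}]$. Then for every instance, $\mathbb E[\textsc{Threshold}]\le\max\{\frac1d,\ \alpha+(2-\alpha)d\}\cdot\mathbb E[\mathrm{OPT}]$. In particular, with $d=2/(\alpha+\sqrt{8-\alpha(4-\alpha)})$, \textsc{Threshold} has competitive ratio at most $\frac12\big(\alpha+\sqrt{8-\alpha(4-\alpha)}\big)$.
   Context: An instance of the graph orientation problem consists of a graph $G=(V,E)$ and, for each vertex $v$, a query cost $c_v\ge0$ and a continuous distribution $d_v$ with minimal support interval $I_v=(\ell_v,r_v)$; it is assumed that $I_u\cap I_v\ne\emptyset$ for each edge $\{u,v\}$ and that neither interval of an edge is contained in the other. Weights $w_v\sim d_v$ are independent and querying $v$ reveals $w_v$ at cost $c_v$; $c(S)=\sum_{v\in S}c_v$. For a realization, $Q$ is a feasible query set if knowing $w_u$ for $u\in Q$ and only the intervals for unqueried vertices suffices to identify, for every edge, its endpoint of minimum weight; $\mathbb E[\mathrm{OPT}]$ is the expected minimum cost of a feasible query set. A vertex is mandatory for a realization if it belongs to every feasible query set; $p_v$ is the probability that $v$ is mandatory (for graphs, $p_v=1-\prod_{u:\{u,v\}\in E}\mathbb P[w_u\notin I_v]$). Algorithm \textsc{Threshold} with parameter $d\in[0,1]$: (1) let $M=\{v:p_v\ge d\}$; (2) compute an optimal basic feasible solution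 $x^*$ of the LP $\min\sum c_vx_v$ s.t. $x_u+x_v\ge1$ for every edge $\{u,v\}$ of $G[V\setminus M]$, $x\ge0$ (such solutions are half-integral); (3) let $V_1,V_{1/2},V_0$ be the vertices of $V\setminus M$ with $x^*_v=1,\frac12,0$ respectively; (4) compute a vertex cover $VC'$ of $G[V_{1/2}]$ with the given approximation algorithm; (5) query $Q=M\cup V_1\cup VC'$; (6) then query every vertex of $V\setminus Q$ that is mandatory (this is determined after step 5). $\mathbb E[\textsc{Threshold}]$ is its expected query cost. -}

module Defs where

open import Level using (0ℓ) renaming (suc to lsuc)
open import Algebra.Bundles using (CommutativeRing)
open import Algebra.Structures using (IsCommutativeRing)
open import Axiom.ExcludedMiddle using (ExcludedMiddle)
open import Data.Bool.Base using (if_then_else_)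
open import Data.Fin.Base using (Fin; toℕ)
open import Data.Fin.Properties using (_≟_)
open import Data.Fin.Subset using (Subset; inside; outside; _∈_; _∉_; _⊆_; ∁; _∪_; ⊤; ∣_∣)
open import Data.Fin.Subset.Properties using (_∈?_)
open import Data.List.Base using (List; []; _∷_; _++_; map; filter; length; lookup)
open import Data.Nat.Base as ℕ using (ℕ)
open import Data.Product.Base using (Σ-syntax; ∃; _×_; _,_)
open import Data.Sum.Base using (_⊎_)
open import Data.Vec.Base using (_∷_; []; tabulate)
open import Function.Base using (_∘_)
open import Relation.Binary.Bundles using (TotalOrder)
open import Relation.Binary.Core using (Rel)
open import Relation.Binary.PropositionalEquality.Core using (_≡_; _≢_)
open import Relation.Binary.Structures using (IsTotalOrder)
open import Relation.Nullary using (¬_; does)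
open import Relation.Unary as U using (Pred; _≐_)

-- The real numbers, axiomatised up to isomorphism as a Dedekind-complete
-- totally ordered field.  The value of _⁻¹ at 0 is unspecified.
record RealField : Set₁ where
  infix  4 _≈_ _≤_
  infixl 6 _+_
  infixl 7 _*_
  infix  8 -_
  infix  9 _⁻¹
  field
    Carrier : Set
    _≈_ _≤_ : Rel Carrier 0ℓ
    _+_ _*_ : Carrier → Carrier → Carrier
    -_ _⁻¹  : Carrier → Carrier
    0# 1#   : Carrier
    isCommutativeRing : IsCommutativeRing _≈_ _+_ _*_ -_ 0# 1#
    isTotalOrder      : IsTotalOrder _≈_ _≤_
    0≉1               : ¬ 0# ≈ 1#
    *-inverseʳ        : ∀ {x} → ¬ x ≈ 0# → x * x ⁻¹ ≈ 1#
    +-monoˡ-≤         : ∀ {x y} z → x ≤ y → x + z ≤ y + z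
    *-nonneg          : ∀ {x y} → 0# ≤ x → 0# ≤ y → 0# ≤ x * y

  IsUpperBound : Pred Carrier 0ℓ → Pred Carrier 0ℓ
  IsUpperBound S b = ∀ {x} → S x → x ≤ b

  field
    supremum : ∀ (S : Pred Carrier 0ℓ) → ∃ S → ∃ (IsUpperBound S) →
               Σ[ s ∈ Carrier ] (IsUpperBound S s × (∀ {b} → IsUpperBound S b → s ≤ b))

  commutativeRing : CommutativeRing 0ℓ 0ℓ
  commutativeRing = record { isCommutativeRing = isCommutativeRing }

  totalOrder : TotalOrder 0ℓ 0ℓ 0ℓ
  totalOrder = record { isTotalOrder = isTotalOrder }

  open CommutativeRing commutativeRing public
    using (_-_; +-rawMonoid; *-rawMonoid)

  open import Relation.Binary.Construct.NonStrictToStrict _≈_ _≤_ public using (_<_)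
  open import Algebra.Construct.NaturalChoice.Max totalOrder public using (_⊔_)
  open import Algebra.Definitions.RawMonoid +-rawMonoid public using (sum)
  open import Algebra.Definitions.RawMonoid *-rawMonoid public using ()
    renaming (sum to product)

  2# 4# 8# ½ : Carrier
  2# = 1# + 1#
  4# = 2# + 2#
  8# = 4# + 4#
  ½  = 2# ⁻¹

  IsSqrt : Carrier → Carrier → Set
  IsSqrt a s = 0# ≤ s × s * s ≈ a

  Converges : (ℕ → Carrier) → Carrier → Set
  Converges a s = ∀ ε → 0# < ε → Σ[ N ∈ ℕ ] (∀ n → N ℕ.≤ n → s - ε < a n × a n < s + ε)

  HasSum : (ℕ → Carrier) → Carrier → Set
  HasSum f = Converges (λ N → sum {N} (λ i → f (toℕ i)))

  ⟨_,_⟩ : Carrier → Carrier → Pred Carrier 0ℓ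
  ⟨ a , b ⟩ x = a < x × x < b


module Probability (ℝ : RealField) where
  open RealField ℝ

  -- Subsets are predicates, so every collection of measurable sets is closed
  -- under extensional equality _≐_.
  record MeasurableSpace : Set₂ where
    field
      Point      : Set
      Measurable : Pred Point 0ℓ → Set₁
      resp       : ∀ {A B} → A ≐ B → Measurable A → Measurable B
      whole      : Measurable U.U
      complement : ∀ {A} → Measurable A → Measurable (U.∁ A)
      union      : ∀ {A : ℕ → Pred Point 0ℓ} → (∀ i → Measurable (A i)) →
                   Measurable (U.⋃ ℕ A)

  data IsBorel : Pred Carrier 0ℓ → Set₁ where
    halfLine   : ∀ x → IsBorel (_≤ x)
    resp       : ∀ {A B} → A ≐ B → IsBorel A → IsBorel B
    whole      : IsBorel U.U
    complement : ∀ {A} → IsBorel A → IsBorel (U.∁ A)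
    union      : ∀ {A : ℕ → Pred Carrier 0ℓ} → (∀ i → IsBorel (A i)) → IsBorel (U.⋃ ℕ A)

  borel : MeasurableSpace
  borel = record
    { Point = Carrier ; Measurable = IsBorel ; resp = resp ; whole = whole
    ; complement = complement ; union = union }

  -- prob is total, but constrained (and meaningful) only on measurable sets.
  record ProbabilityMeasure (X : MeasurableSpace) : Set₁ where
    open MeasurableSpace X
    field
      prob       : Pred Point 0ℓ → Carrier
      prob-cong  : ∀ {A B} → A ≐ B → Measurable A → prob A ≈ prob B
      prob-nonneg : ∀ {A} → Measurable A → 0# ≤ prob A
      prob-whole : prob U.U ≈ 1#
      σ-additive : ∀ {A : ℕ → Pred Point 0ℓ} → (∀ i → Measurable (A i)) →
                   (∀ {i j} → i ≢ j → ∀ {ω} → A i ω → ¬ A j ω) →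
                   HasSum (λ i → prob (A i)) (prob (U.⋃ ℕ A))

  open ProbabilityMeasure public using (prob)

  Distribution : Set₁
  Distribution = ProbabilityMeasure borel

  cdf : Distribution → Carrier → Carrier
  cdf μ x = prob μ (_≤ x)

  IsContinuous : Distribution → Set
  IsContinuous μ = ∀ x ε → 0# < ε → Σ[ δ ∈ Carrier ] (0# < δ ×
    (∀ y → ⟨ x - δ , x + δ ⟩ y → ⟨ cdf μ x - ε , cdf μ x + ε ⟩ (cdf μ y)))

  IsMinimalSupport : Distribution → Carrier → Carrier → Set
  IsMinimalSupport μ l r = prob μ ⟨ l , r ⟩ ≈ 1# ×
    (∀ a b → prob μ ⟨ a , b ⟩ ≈ 1# → a ≤ l × r ≤ b)


-- Excluded middle makes the classical case distinctions (sets of vertices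
-- defined by properties of real numbers) available.
module GraphOrientation (em : ExcludedMiddle 0ℓ) (ℝ : RealField) where
  open RealField ℝ
  open Probability ℝ
  open import Data.List.Extrema totalOrder using (argmin)

  ⟪_⟫ : ∀ {n} → Pred (Fin n) 0ℓ → Subset n
  ⟪ A ⟫ = tabulate (λ v → does (em {A v}))

  subsets : ∀ n → List (Subset n)
  subsets ℕ.zero    = [] ∷ []
  subsets (ℕ.suc n) = map (inside ∷_) (subsets n) ++ map (outside ∷_) (subsets n)

  weight : ∀ {n} → (Fin n → Carrier) → Subset n → Carrier
  weight c S = sum (λ v → if does (v ∈? S) then c v else 0#)

  record Graph (n : ℕ) : Set₁ where
    infix 4 _~_
    field
      _~_    : Rel (Fin n) 0ℓ
      symm   : ∀ {u v} → u ~ v → v ~ u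
      irrefl : ∀ {v} → ¬ v ~ v

  IsVertexCover : ∀ {n} → Graph n → Subset n → Subset n → Set
  IsVertexCover G S C = C ⊆ S × (∀ {u v} → u ∈ S → v ∈ S → u ~ v → u ∈ C ⊎ v ∈ C)
    where open Graph G

  -- The vertex cover LP of the induced subgraph G[S]: its variables are x v for
  -- v ∈ S, and entries of x : Fin n → ℝ outside S play no role.
  module VertexCoverLP {n} (G : Graph n) (c : Fin n → Carrier) (S : Subset n) where
    open Graph G

    data Constraint : Set where
      edge   : ∀ {u v} → u ∈ S → v ∈ S → u ~ v → Constraint
      nonneg : ∀ {v} → v ∈ S → Constraint

    lhs : Constraint → (Fin n → Carrier) → Carrier
    lhs (edge {u} {v} _ _ _) x = x u + x v
    lhs (nonneg {v} _)       x = x v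

    rhs : Constraint → Carrier
    rhs (edge _ _ _) = 1#
    rhs (nonneg _)   = 0#

    unit : Fin n → Fin n → Carrier
    unit v w = if does (v ≟ w) then 1# else 0#

    row : Constraint → Fin n → Carrier
    row k w = lhs k (λ v → unit v w)

    Feasible : (Fin n → Carrier) → Set
    Feasible x = ∀ k → rhs k ≤ lhs k x

    objective : (Fin n → Carrier) → Carrier
    objective x = weight (λ v → c v * x v) S

    LinearlyIndependent : ∀ {m} → (Fin m → Fin n → Carrier) → Set
    LinearlyIndependent {m} a = ∀ (t : Fin m → Carrier) →
      (∀ w → sum (λ i → t i * a i w) ≈ 0#) → ∀ i → t i ≈ 0#

    -- Basic: as many linearly independent active constraints as variables.
    IsBasic : (Fin n → Carrier) → Set
    IsBasic x = Σ[ k ∈ (Fin ∣ S ∣ → Constraint) ]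
      ((∀ i → lhs (k i) x ≈ rhs (k i)) × LinearlyIndependent (row ∘ k))

    IsOptimalBFS : (Fin n → Carrier) → Set
    IsOptimalBFS x = Feasible x × IsBasic x ×
      (∀ y → Feasible y → objective x ≤ objective y)

  record Instance (n : ℕ) : Set₂ where
    field
      graph : Graph n
      cost  : Fin n → Carrier
      dist  : Fin n → Distribution
      left right : Fin n → Carrier
    open Graph graph public
    Interval : Fin n → Pred Carrier 0ℓ
    Interval v = ⟨ left v , right v ⟩
    field
      cost-nonneg     : ∀ v → 0# ≤ cost v
      dist-continuous : ∀ v → IsContinuous (dist v)
      minimal-support : ∀ v → IsMinimalSupport (dist v) (left v) (right v)
      intersecting    : ∀ {u v} → u ~ v → ∃ λ x → Interval u x × Interval v x
      no-containment  : ∀ {u v} → u ~ v → ¬ Interval u U.⊆ Interval v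

  module _ {n} (I : Instance n) where
    open Instance I

    -- The realizations w′ that remain possible after querying Q under w.
    Consistent : (Fin n → Carrier) → Subset n → Pred (Fin n → Carrier) 0ℓ
    Consistent w Q w′ = ∀ v → (v ∈ Q → w′ v ≈ w v) × (v ∉ Q → Interval v (w′ v))

    -- Non-strict comparisons: when both weights are known and tied, either
    -- endpoint is a correct answer.
    IsFeasibleQuerySet : (Fin n → Carrier) → Pred (Subset n) 0ℓ
    IsFeasibleQuerySet w Q = ∀ {u v} → u ~ v →
        (∀ w′ → Consistent w Q w′ → w′ u ≤ w′ v)
      ⊎ (∀ w′ → Consistent w Q w′ → w′ v ≤ w′ u)

    -- A cheapest feasible query set; the full vertex set ⊤ is always feasible.
    optimalQuerySet : (Fin n → Carrier) → Subset n
    optimalQuerySet w =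
      argmin (weight cost) ⊤ (filter (λ Q → em {IsFeasibleQuerySet w Q}) (subsets n))

    IsMandatory : (Fin n → Carrier) → Pred (Fin n) 0ℓ
    IsMandatory w v = ∀ Q → IsFeasibleQuerySet w Q → v ∈ Q

    -- Independent random weights with the prescribed distributions, on an
    -- arbitrary probability space.
    record RandomWeights : Set₂ where
      field
        space   : MeasurableSpace
        measure : ProbabilityMeasure space
      open MeasurableSpace space public renaming (Point to Ω)

      ℙ : Pred Ω 0ℓ → Carrier
      ℙ = prob measure

      field
        w           : Fin n → Ω → Carrier
        measurable  : ∀ v {B} → IsBorel B → Measurable (B ∘ w v)
        distributed : ∀ v {B} → IsBorel B → ℙ (B ∘ w v) ≈ prob (dist v) B
        independent : ∀ (B : Fin n → Pred Carrier 0ℓ) → (∀ v → IsBorel (B v)) →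
                      ℙ (λ ω → ∀ v → B v (w v ω)) ≈ product (λ v → ℙ (B v ∘ w v))

      realization : Ω → Fin n → Carrier
      realization ω v = w v ω

      -- Expected cost of a random query set, which takes finitely many values:
      -- 𝔼[c(T)] = ∑_Q c(Q) ℙ[T = Q].
      𝔼[cost_] : (Ω → Subset n) → Carrier
      𝔼[cost T ] = sum (λ i → let Q = lookup (subsets n) i in
                              weight cost Q * ℙ (λ ω → T ω ≡ Q))

      𝔼[OPT] : Carrier
      𝔼[OPT] = 𝔼[cost (λ ω → optimalQuerySet (realization ω)) ]

      mandatoryProb : Fin n → Carrier
      mandatoryProb v = ℙ (λ ω → IsMandatory (realization ω) v)

    -- An execution of Threshold with parameter d.  The solution of the LP and
    -- the α-approximate vertex cover are arbitrary ones that meet the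
    -- requirements, so that every choice of LP solver and vertex cover
    -- algorithm is covered.
    record ThresholdRun (W : RandomWeights) (α d : Carrier) : Set where
      open RandomWeights W

      M : Subset n
      M = ⟪ (λ v → d ≤ mandatoryProb v) ⟫

      open VertexCoverLP graph cost (∁ M) using (IsOptimalBFS)

      field
        x*         : Fin n → Carrier
        x*-optimal : IsOptimalBFS x*

      V₁ : Subset n
      V₁ = ⟪ (λ v → v ∉ M × x* v ≈ 1#) ⟫
      V½ : Subset n
      V½ = ⟪ (λ v → v ∉ M × x* v ≈ ½) ⟫
      V₀ : Subset n
      V₀ = ⟪ (λ v → v ∉ M × x* v ≈ 0#) ⟫

      field
        VC′        : Subset n
        VC′-cover  : IsVertexCover graph V½ VC′
        VC′-approx : ∀ C → IsVertexCover graph V½ C →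
                     weight cost VC′ ≤ α * weight cost C

      Q : Subset n
      Q = M ∪ V₁ ∪ VC′

      queried : Ω → Subset n
      queried ω = Q ∪ ⟪ (λ v → v ∉ Q × IsMandatory (realization ω) v) ⟫

      𝔼[Threshold] : Carrier
      𝔼[Threshold] = 𝔼[cost queried ]

  -- Threshold with parameter d and an α-approximation for vertex cover has
  -- competitive ratio at most ρ.
  ThresholdCompetitive : (α d ρ : Carrier) → Set₂
  ThresholdCompetitive α d ρ =
    ∀ {n} (I : Instance n) (W : RandomWeights I) (R : ThresholdRun I W α d) →
    ThresholdRun.𝔼[Threshold] R ≤ ρ * RandomWeights.𝔼[OPT] W

{-# OPTIONS --safe #-}
module Submission where

-- Let p v and q v be the probabilities that v is mandatory and that v belongs
-- to the optimal query set.  A feasible query set is a vertex cover containing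
-- all mandatory vertices, so p ≤ q and q u + q v ≥ 1 on every edge.  Mix the LP
-- optimum with q: the vector
--   ½ (1 + (1+d) q) on V₁,   ½ ((1+d) q − p) on V₀,   ½ (1 − d) + d q on V½
-- is LP-feasible because p ≤ d outside M.  Comparing its objective with the
-- optimal one gives c(V₁) + Σ_{V₀} c p + d c(V½) ≤ (1+d) Σ_{V₁ ∪ V₀} c q + 2d Σ_{V½} c q,
-- and averaging c(VC′) ≤ α c(OPT ∩ V½) accounts for the covered part of V½.

open import Level using (0ℓ)
open import Algebra.Bundles using (CommutativeRing)
import Algebra.Properties.Ring as RingProperties
import Algebra.Properties.Semiring.Mult.TCOptimised as Multiples
import Algebra.Properties.Semiring.Sum as SemiringSum
import Algebra.Solver.Ring as RingSolver
open import Algebra.Solver.Ring.AlmostCommutativeRing using (fromCommutativeRing; _-Raw-AlmostCommutative⟶_)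
open import Axiom.ExcludedMiddle using (ExcludedMiddle)
open import Data.Bool.Base using (if_then_else_)
open import Data.Empty using (⊥-elim)
open import Data.Fin.Base using (Fin; zero; suc; toℕ; punchIn)
open import Data.Fin.Properties using (_≟_)
open import Data.Fin.Subset using (Subset; inside; outside; ∣_∣; ⊤; ∁; ⁅_⁆; _∪_; _∩_)
  renaming (_-_ to _-ˢ_; _∈_ to _∈ˢ_; _∉_ to _∉ˢ_; _⊆_ to _⊆ˢ_)
open import Data.Fin.Subset.Properties
  using ( drop-there; x∈p⇒∣p-x∣<∣p∣; x∈p∧x≢y⇒x∈p-y; ∈⊤; x∉p⇒x∈∁p; x∈∁p⇒x∉p; x∈⁅x⁆; x∈⁅y⁆⇒x≡y
        ; x∈p∪q⁺; x∈p∪q⁻; x∈p∩q⁺; x∈p∩q⁻; p∩q⊆p)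
  renaming (_∈?_ to _∈ˢ?_)
open import Data.Integer.Base as ℤ using (ℤ; +_; -[1+_]; _⊖_)
import Data.Integer.Properties as ℤₚ
open import Data.List.Base using ([]; _∷_; lookup; map; length; filter)
open import Data.List.Membership.Propositional using (_∈_)
open import Data.List.Membership.Propositional.Properties using (∈-++⁺ˡ; ∈-++⁺ʳ; ∈-map⁺; ∈-map⁻; ∈-filter⁻)
open import Data.List.Properties using (filter-≐)
open import Data.List.Relation.Unary.All as All using ()
open import Data.List.Relation.Unary.AllPairs using ([]; _∷_)
open import Data.List.Relation.Unary.Any using (here; there)
open import Data.List.Relation.Unary.Unique.Propositional using (Unique)
open import Data.List.Relation.Unary.Unique.Propositional.Properties using (map⁺; ++⁺)
open import Data.Maybe.Base using (Maybe; just; nothing)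
open import Data.Nat.Base as ℕ using (ℕ; zero; suc)
import Data.Nat.Properties as ℕₚ
open import Data.Product.Base using (Σ-syntax; ∃; _×_; _,_; proj₁; proj₂)
open import Data.Sum.Base as Sum using (_⊎_; inj₁; inj₂; [_,_]′; swap)
open import Data.Vec.Base using ([]; _∷_)
open import Data.Vec.Functional using (insertAt; updateAt)
open import Data.Vec.Functional.Properties
  using (insertAt-lookup; insertAt-punchIn; updateAt-updates; updateAt-minimal)
open import Data.Vec.Properties using (∷-injectiveʳ; lookup∘tabulate; lookup⇒[]=; []=⇒lookup)
open import Function.Base using (_∘_; const)
open import Relation.Binary.PropositionalEquality as ≡ using (_≡_; _≢_)
open import Relation.Binary.Structures using (IsTotalOrder)
open import Relation.Nullary using (¬_; yes; no; does; contradiction)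
open import Relation.Nullary.Decidable using (toSum)
open import Relation.Unary as U using (Pred; _≐_)
open import Defs

-- The estimate adds LP optimality against the test vector, with multiplier 2, to the cover bound,
-- with multiplier 1 - d; what is left then holds at every vertex separately. On `V½` the LP
-- comparison leaves a budget of d per unit of cost, which pays for p ≤ d outside `VC′`. A vertex of
-- `VC′` needs 1 - d more, hence the second multiplier. The coefficients of q add up to 2d + (1 -
-- d)α = α + (2 - α)d on `V½` and to 1 + d on `V₁` and `V₀`, which is no larger because α ≥ 1 and d
-- ≤ 1. Vertices of `M` are charged to OPT alone: q ≥ p ≥ d there, whence 1/d.
--
-- Two facts often taken for granted need real work. Half-integrality has to be extracted from the
-- linear independence of the active rows. And `prob` is constrained on measurable sets only, while
-- OPT is an argmin chosen anew for each outcome; its events become measurable because OPT is a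
-- function of the set of mandatory vertices, and a vertex is mandatory exactly when some
-- neighbour's weight falls into its interval.

-- A ring solver with integer coefficients.

module IntegerCoefficients (R : CommutativeRing 0ℓ 0ℓ) where
  open CommutativeRing R
  open RingProperties ring using (-‿distribˡ-*; -‿distribʳ-*; -‿involutive; -‿+-comm; -0#≈0#)
  open Multiples semiring
    using (×-homo-+; ×1-homo-*) renaming (_×_ to _⨯_)
  open import Relation.Binary.Reasoning.Setoid setoid

  ⟦_⟧ᶻ : ℤ → Carrier
  ⟦ + n ⟧ᶻ      = n ⨯ 1#
  ⟦ -[1+ n ] ⟧ᶻ = - (suc n ⨯ 1#)

  private
    suc-⨯ : ∀ n → suc n ⨯ 1# ≈ 1# + n ⨯ 1#
    suc-⨯ n = ×-homo-+ 1# 1 n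

  ⊖-homo : ∀ m n → ⟦ m ⊖ n ⟧ᶻ ≈ m ⨯ 1# - n ⨯ 1#
  ⊖-homo m zero = sym (trans (+-congˡ -0#≈0#) (+-identityʳ _))
  ⊖-homo zero (suc n) = sym (+-identityˡ _)
  ⊖-homo (suc m) (suc n) = begin
    ⟦ suc m ⊖ suc n ⟧ᶻ               ≡⟨ ≡.cong ⟦_⟧ᶻ (ℤₚ.[1+m]⊖[1+n]≡m⊖n m n) ⟩
    ⟦ m ⊖ n ⟧ᶻ                       ≈⟨ ⊖-homo m n ⟩
    a - b                            ≈⟨ +-congʳ (+-identityˡ a) ⟨
    0# + a - b                       ≈⟨ +-congʳ (+-congʳ (-‿inverseʳ 1#)) ⟨
    1# - 1# + a - b                  ≈⟨ +-congʳ (trans (+-assoc _ _ _) (+-congˡ (+-comm _ _))) ⟩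
    1# + (a - 1#) - b                ≈⟨ trans (+-congʳ (sym (+-assoc _ _ _))) (+-assoc _ _ _) ⟩
    1# + a + (- 1# - b)              ≈⟨ +-congˡ (-‿+-comm 1# b) ⟩
    1# + a - (1# + b)                ≈⟨ +-cong (suc-⨯ m) (-‿cong (suc-⨯ n)) ⟨
    suc m ⨯ 1# - suc n ⨯ 1#          ∎
    where
    a = m ⨯ 1#
    b = n ⨯ 1#

  +-homo : ∀ i j → ⟦ i ℤ.+ j ⟧ᶻ ≈ ⟦ i ⟧ᶻ + ⟦ j ⟧ᶻ
  +-homo (+ m) (+ n) = ×-homo-+ 1# m n
  +-homo (+ m) -[1+ n ] = ⊖-homo m (suc n)
  +-homo -[1+ m ] (+ n) = trans (⊖-homo n (suc m)) (+-comm _ _)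
  +-homo -[1+ m ] -[1+ n ] = begin
    - (suc (suc (m ℕ.+ n)) ⨯ 1#)            ≡⟨ ≡.cong (λ k → - (suc k ⨯ 1#)) (ℕₚ.+-suc m n) ⟨
    - ((suc m ℕ.+ suc n) ⨯ 1#)              ≈⟨ -‿cong (×-homo-+ 1# (suc m) (suc n)) ⟩
    - (suc m ⨯ 1# + suc n ⨯ 1#)             ≈⟨ -‿+-comm _ _ ⟨
    - (suc m ⨯ 1#) - suc n ⨯ 1#             ∎

  -‿homo : ∀ i → ⟦ ℤ.- i ⟧ᶻ ≈ - ⟦ i ⟧ᶻ
  -‿homo (+ zero) = sym -0#≈0#
  -‿homo (+ suc n) = refl
  -‿homo -[1+ n ] = sym (-‿involutive _)

  private
    +*+-homo : ∀ m n → ⟦ + m ℤ.* + n ⟧ᶻ ≈ (m ⨯ 1#) * (n ⨯ 1#)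
    +*+-homo m n = trans (reflexive (≡.cong ⟦_⟧ᶻ (≡.sym (ℤₚ.pos-* m n)))) (×1-homo-* m n)

  *-homo : ∀ i j → ⟦ i ℤ.* j ⟧ᶻ ≈ ⟦ i ⟧ᶻ * ⟦ j ⟧ᶻ
  *-homo (+ m) (+ n) = +*+-homo m n
  *-homo (+ m) -[1+ n ] = begin
    ⟦ + m ℤ.* -[1+ n ] ⟧ᶻ          ≡⟨ ≡.cong ⟦_⟧ᶻ (ℤₚ.neg-distribʳ-* (+ m) (+ suc n)) ⟨
    ⟦ ℤ.- (+ m ℤ.* + suc n) ⟧ᶻ     ≈⟨ -‿homo (+ m ℤ.* + suc n) ⟩
    - ⟦ + m ℤ.* + suc n ⟧ᶻ         ≈⟨ -‿cong (+*+-homo m (suc n)) ⟩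
    - (m ⨯ 1# * (suc n ⨯ 1#))      ≈⟨ -‿distribʳ-* _ _ ⟩
    m ⨯ 1# * - (suc n ⨯ 1#)        ∎
  *-homo -[1+ m ] (+ n) = begin
    ⟦ -[1+ m ] ℤ.* + n ⟧ᶻ          ≡⟨ ≡.cong ⟦_⟧ᶻ (ℤₚ.neg-distribˡ-* (+ suc m) (+ n)) ⟨
    ⟦ ℤ.- (+ suc m ℤ.* + n) ⟧ᶻ     ≈⟨ -‿homo (+ suc m ℤ.* + n) ⟩
    - ⟦ + suc m ℤ.* + n ⟧ᶻ         ≈⟨ -‿cong (+*+-homo (suc m) n) ⟩
    - (suc m ⨯ 1# * (n ⨯ 1#))      ≈⟨ -‿distribˡ-* _ _ ⟩
    - (suc m ⨯ 1#) * (n ⨯ 1#)      ∎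
  *-homo -[1+ m ] -[1+ n ] = begin
    (suc m ℕ.* suc n) ⨯ 1#             ≈⟨ ×1-homo-* (suc m) (suc n) ⟩
    suc m ⨯ 1# * (suc n ⨯ 1#)          ≈⟨ -‿involutive _ ⟨
    - - (suc m ⨯ 1# * (suc n ⨯ 1#))    ≈⟨ -‿cong (-‿distribˡ-* _ _) ⟩
    - (- (suc m ⨯ 1#) * (suc n ⨯ 1#))  ≈⟨ -‿distribʳ-* _ _ ⟩
    - (suc m ⨯ 1#) * - (suc n ⨯ 1#)    ∎

  -- The solver normalises by comparing coefficients. Equality of integers is decidable, equality in
  -- an arbitrary commutative ring is not.
  homomorphism : ℤ.+-*-rawRing -Raw-AlmostCommutative⟶ fromCommutativeRing R
  homomorphism = record
    { ⟦_⟧ = ⟦_⟧ᶻ ; +-homo = +-homo ; *-homo = *-homo ; -‿homo = -‿homo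
    ; 0-homo = refl ; 1-homo = refl }

  private
    coefficient≟ : ∀ i j → Maybe (⟦ i ⟧ᶻ ≈ ⟦ j ⟧ᶻ)
    coefficient≟ i j with i ℤₚ.≟ j
    ... | yes i≡j = just (reflexive (≡.cong ⟦_⟧ᶻ i≡j))
    ... | no  _   = nothing

  open RingSolver ℤ.+-*-rawRing (fromCommutativeRing R) homomorphism coefficient≟ public
    using (Polynomial; solve; con; _:=_; _:+_; _:*_; _:-_; :-_)

  :0 :1 : ∀ {n} → Polynomial n
  :0 = con (+ 0)
  :1 = con (+ 1)

-- Arithmetic of inequalities in an ordered field.

module OrderedField (ℝ : RealField) where
  open RealField ℝ
  open CommutativeRing commutativeRing
    using (refl; sym; trans; +-congˡ; +-congʳ; *-congˡ; *-congʳ; *-comm; +-identityˡ; +-identityʳ;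
        *-identityˡ; zeroʳ; setoid)
  module ≈-Reasoning where
    open import Relation.Binary.Reasoning.Setoid setoid public
  open IntegerCoefficients commutativeRing
  open IsTotalOrder isTotalOrder public using (antisym; total; ≤-respˡ-≈; ≤-respʳ-≈)
    renaming (trans to ≤-trans; refl to ≤-refl; reflexive to ≤-reflexive)
  import Relation.Binary.Construct.NonStrictToStrict _≈_ _≤_ as Strict

  -- The standard form of an inequality proof below: exhibit the slack `t`, show it nonnegative, and
  -- leave the identity to the solver.
  ≤-by : ∀ {a b} t → 0# ≤ t → a + t ≈ b → a ≤ b
  ≤-by {a} t 0≤t a+t≈b =
    ≤-respˡ-≈ (+-identityˡ a) (≤-respʳ-≈ (trans (solve 2 (λ x y → x :+ y := y :+ x) refl t a) a+t≈b)
        (+-monoˡ-≤ a 0≤t))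

  x≤y⇒0≤y-x : ∀ {x y} → x ≤ y → 0# ≤ y - x
  x≤y⇒0≤y-x {x} x≤y =
    ≤-respˡ-≈ (solve 1 (λ x → x :- x := :0) refl x) (+-monoˡ-≤ (- x) x≤y)

  +-mono-≤ : ∀ {x y u v} → x ≤ y → u ≤ v → x + u ≤ y + v
  +-mono-≤ {x} {y} {u} {v} x≤y u≤v = ≤-trans (+-monoˡ-≤ u x≤y)
    (≤-respˡ-≈ (solve 2 (λ x y → x :+ y := y :+ x) refl u y)
      (≤-respʳ-≈ (solve 2 (λ x y → x :+ y := y :+ x) refl v y) (+-monoˡ-≤ y u≤v)))

  +-nonneg : ∀ {x y} → 0# ≤ x → 0# ≤ y → 0# ≤ x + y
  +-nonneg 0≤x 0≤y = ≤-respˡ-≈ (+-identityʳ 0#) (+-mono-≤ 0≤x 0≤y)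

  *-monoˡ-≤ : ∀ {a x y} → 0# ≤ a → x ≤ y → a * x ≤ a * y
  *-monoˡ-≤ {a} {x} {y} 0≤a x≤y = ≤-by (a * (y - x)) (*-nonneg 0≤a (x≤y⇒0≤y-x x≤y))
    (solve 3 (λ a x y → a :* x :+ a :* (y :- x) := a :* y) refl a x y)

  *-monoʳ-≤ : ∀ {a x y} → 0# ≤ a → x ≤ y → x * a ≤ y * a
  *-monoʳ-≤ {a} {x} {y} 0≤a x≤y =
    ≤-respˡ-≈ (*-comm a x) (≤-respʳ-≈ (*-comm a y) (*-monoˡ-≤ 0≤a x≤y))

  0≤x*x : ∀ x → 0# ≤ x * x
  0≤x*x x with total 0# x
  ... | inj₁ 0≤x = *-nonneg 0≤x 0≤x
  ... | inj₂ x≤0 = ≤-respʳ-≈ (solve 1 (λ x → (:0 :- x) :* (:0 :- x) := x :* x) refl x)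
    (*-nonneg (x≤y⇒0≤y-x x≤0) (x≤y⇒0≤y-x x≤0))

  0≤1 : 0# ≤ 1#
  0≤1 = ≤-respʳ-≈ (*-identityˡ 1#) (0≤x*x 1#)

  0<1 : 0# < 1#
  0<1 = 0≤1 , 0≉1

  <⇒≱ : ∀ {x y} → x < y → ¬ y ≤ x
  <⇒≱ = Strict.<⇒≱ antisym

  ≰⇒> : ∀ {x y} → ¬ x ≤ y → y < x
  ≰⇒> = Strict.≰⇒> sym ≤-reflexive total

  <-irrefl : ∀ {x} → ¬ x < x
  <-irrefl x<x = proj₂ x<x refl

  <-≤-trans : ∀ {x y z} → x < y → y ≤ z → x < z
  <-≤-trans = Strict.<-≤-trans sym ≤-trans antisym ≤-respʳ-≈

  ≤-<-trans : ∀ {x y z} → x ≤ y → y < z → x < z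
  ≤-<-trans = Strict.≤-<-trans ≤-trans antisym ≤-respˡ-≈

  <-trans : ∀ {x y z} → x < y → y < z → x < z
  <-trans x<y y<z = <-≤-trans x<y (proj₁ y<z)

  <-respˡ-≈ : ∀ {x y z} → x ≈ y → x < z → y < z
  <-respˡ-≈ x≈y x<z = ≤-<-trans (≤-reflexive (sym x≈y)) x<z

  <-respʳ-≈ : ∀ {x y z} → y ≈ z → x < y → x < z
  <-respʳ-≈ y≈z x<y = <-≤-trans x<y (≤-reflexive y≈z)

  <-by : ∀ {a b} t → 0# < t → a + t ≈ b → a < b
  <-by {a} {b} t (0≤t , 0≉t) a+t≈b = ≤-by t 0≤t a+t≈b , λ a≈b → 0≉t (begin
    0#           ≈⟨ solve 1 (λ a → :0 := a :- a) refl a ⟩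
    a - a        ≈⟨ +-congʳ (trans a≈b (sym a+t≈b)) ⟩
    a + t - a    ≈⟨ solve 2 (λ a t → a :+ t :- a := t) refl a t ⟩
    t            ∎)
    where open ≈-Reasoning

  x<y⇒0<y-x : ∀ {x y} → x < y → 0# < y - x
  x<y⇒0<y-x {x} {y} (x≤y , x≉y) = x≤y⇒0≤y-x x≤y , λ 0≈y-x → x≉y (begin
    x            ≈⟨ solve 1 (λ x → x := :0 :+ x) refl x ⟩
    0# + x       ≈⟨ +-congʳ 0≈y-x ⟩
    y - x + x    ≈⟨ solve 2 (λ x y → y :- x :+ x := y) refl x y ⟩
    y            ∎)
    where open ≈-Reasoning

  0<⇒≉0 : ∀ {x} → 0# < x → ¬ x ≈ 0#
  0<⇒≉0 (_ , 0≉x) x≈0 = 0≉x (sym x≈0)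

  *-cancelˡ-0 : ∀ {a b} → ¬ a ≈ 0# → a * b ≈ 0# → b ≈ 0#
  *-cancelˡ-0 {a} {b} a≉0 ab≈0 = begin
    b               ≈⟨ *-identityˡ b ⟨
    1# * b          ≈⟨ *-congʳ (*-inverseʳ a≉0) ⟨
    a * a ⁻¹ * b    ≈⟨ solve 3 (λ a i b → a :* i :* b := i :* (a :* b)) refl a (a ⁻¹) b ⟩
    a ⁻¹ * (a * b)  ≈⟨ *-congˡ ab≈0 ⟩
    a ⁻¹ * 0#       ≈⟨ zeroʳ _ ⟩
    0#              ∎
    where open ≈-Reasoning

  *-cancelˡ-nonneg : ∀ {a b} → 0# < a → 0# ≤ a * b → 0# ≤ b
  *-cancelˡ-nonneg {a} {b} 0<a 0≤ab with total 0# b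
  ... | inj₁ 0≤b = 0≤b
  ... | inj₂ b≤0 = ≤-reflexive (sym (*-cancelˡ-0 (0<⇒≉0 0<a) (antisym
          (≤-by (a * (0# - b)) (*-nonneg (proj₁ 0<a) (x≤y⇒0≤y-x b≤0))
            (solve 2 (λ a b → a :* b :+ a :* (:0 :- b) := :0) refl a b))
          0≤ab)))

  *-pos : ∀ {a b} → 0# < a → 0# < b → 0# < a * b
  *-pos (0≤a , 0≉a) (0≤b , 0≉b) = *-nonneg 0≤a 0≤b ,
    λ 0≈ab → 0≉b (sym (*-cancelˡ-0 (λ a≈0 → 0≉a (sym a≈0)) (sym 0≈ab)))

  ⁻¹-pos : ∀ {a} → 0# < a → 0# < a ⁻¹
  ⁻¹-pos {a} 0<a =
    *-cancelˡ-nonneg 0<a (≤-respʳ-≈ (sym a*a⁻¹≈1) 0≤1) ,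
    λ 0≈a⁻¹ → 0≉1 (trans (sym (zeroʳ a)) (trans (*-congˡ 0≈a⁻¹) a*a⁻¹≈1))
    where a*a⁻¹≈1 = *-inverseʳ (0<⇒≉0 0<a)

  +-pos-nonneg : ∀ {a b} → 0# < a → 0# ≤ b → 0# < a + b
  +-pos-nonneg {a} {b} 0<a 0≤b = <-≤-trans 0<a (≤-by b 0≤b refl)

  0<2 : 0# < 2#
  0<2 = +-pos-nonneg 0<1 0≤1

  ½+½≈1 : ½ + ½ ≈ 1#
  ½+½≈1 = trans (solve 1 (λ h → h :+ h := (:1 :+ :1) :* h) refl ½) (*-inverseʳ (0<⇒≉0 0<2))

  0<½ : 0# < ½
  0<½ = ⁻¹-pos 0<2

  ½<1 : ½ < 1#
  ½<1 = <-by ½ 0<½ ½+½≈1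

  *-cancelˡ-≤ : ∀ {a x y} → 0# < a → a * x ≤ a * y → x ≤ y
  *-cancelˡ-≤ {a} {x} {y} 0<a ax≤ay = ≤-by (y - x)
    (*-cancelˡ-nonneg 0<a (≤-respʳ-≈
      (solve 3 (λ a x y → a :* y :- a :* x := a :* (y :- x)) refl a x y) (x≤y⇒0≤y-x ax≤ay)))
    (solve 2 (λ x y → x :+ (y :- x) := y) refl x y)

  -- The difference y² - x² is (y + x)(y - x), and the positive factor cancels.
  square-cancel-≤ : ∀ {x y} → 0# < y + x → x * x ≤ y * y → x ≤ y
  square-cancel-≤ {x} {y} 0<y+x x²≤y² = *-cancelˡ-≤ 0<y+x
    (≤-by (y * y - x * x) (x≤y⇒0≤y-x x²≤y²)
      (solve 2 (λ x y → (y :+ x) :* x :+ (y :* y :- x :* x) := (y :+ x) :* y) refl x y))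

  <-dense : ∀ {x y} → x < y → ∃ λ z → x < z × z < y
  <-dense {x} {y} x<y = x + e ,
    <-by e 0<e refl ,
    <-by e 0<e (begin
      x + e + e
        ≈⟨ solve 3 (λ x y h → x :+ h :* (y :- x) :+ h :* (y :- x) := x :+ (h :+ h) :* (y :- x)) refl x y ½ ⟩
      x + (½ + ½) * (y - x)    ≈⟨ +-congˡ (*-congʳ ½+½≈1) ⟩
      x + 1# * (y - x)         ≈⟨ solve 2 (λ x y → x :+ :1 :* (y :- x) := y) refl x y ⟩
      y                        ∎)
    where
    open ≈-Reasoning
    e   = ½ * (y - x)
    0<e = *-pos 0<½ (x<y⇒0<y-x x<y)

  sum-mono : ∀ {n} {f g : Fin n → Carrier} → (∀ i → f i ≤ g i) → sum f ≤ sum g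
  sum-mono {zero}  f≤g = ≤-refl
  sum-mono {suc n} f≤g = +-mono-≤ (f≤g zero) (sum-mono (λ i → f≤g (suc i)))

-- Consequences of completeness: the Archimedean property and square roots.

module Classical (em : ExcludedMiddle 0ℓ) (ℝ : RealField) where
  open RealField ℝ
  open OrderedField ℝ
  open CommutativeRing commutativeRing
    using (refl; sym; trans; +-congˡ; +-congʳ; *-cong; *-congˡ; zeroʳ; -‿cong; setoid; semiring)
  open IntegerCoefficients commutativeRing
  open Multiples semiring using (1+×) renaming (_×_ to _⨯_)
  open import Relation.Binary.Reasoning.Setoid setoid

  ≤-limit : ∀ {x y} → (∀ ε → 0# < ε → x ≤ y + ε) → x ≤ y
  ≤-limit {x} {y} x≤y+ε with em {x ≤ y}
  ... | yes x≤y = x≤y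
  ... | no x≰y with z , y<z , z<x ← <-dense (≰⇒> x≰y) = contradiction
    (≤-respʳ-≈ (solve 2 (λ y z → y :+ (z :- y) := z) refl y z) (x≤y+ε (z - y) (x<y⇒0<y-x y<z)))
    (<⇒≱ z<x)

  -- Otherwise `x` bounds all multiples of `1#`. Their supremum s satisfies 1 + y ≤ s for every
  -- multiple y, so s - 1 would be a smaller upper bound.
  archimedean : ∀ x → Σ[ n ∈ ℕ ] x < n ⨯ 1#
  archimedean x with em {Σ[ n ∈ ℕ ] x < n ⨯ 1#}
  ... | yes ∃n = ∃n
  ... | no ∄n = contradiction s≤s-1 (<⇒≱ (<-by 1# 0<1 (solve 1 (λ s → s :- :1 :+ :1 := s) refl s)))
    where
    multiple : Carrier → Set
    multiple y = Σ[ n ∈ ℕ ] y ≈ n ⨯ 1#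
    x-bound : IsUpperBound multiple x
    x-bound (n , y≈n) = ≤-respˡ-≈ (sym y≈n) (decide (total x (n ⨯ 1#)))
      where
      decide : x ≤ n ⨯ 1# ⊎ n ⨯ 1# ≤ x → n ⨯ 1# ≤ x
      decide (inj₂ n≤x) = n≤x
      decide (inj₁ x≤n) with em {x ≈ n ⨯ 1#}
      ... | yes x≈n = ≤-reflexive (sym x≈n)
      ... | no  x≉n = contradiction (n , x≤n , x≉n) ∄n
    lub = supremum multiple (0# , 0 , refl) (x , x-bound)
    s   = proj₁ lub
    s≤s-1 : s ≤ s - 1#
    s≤s-1 = proj₂ (proj₂ lub) λ { {y} (n , y≈n) →
      ≤-by (s - (1# + y))
        (x≤y⇒0≤y-x (proj₁ (proj₂ lub) (suc n , trans (+-congˡ y≈n) (sym (1+× n 1#)))))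
        (solve 2 (λ y s → y :+ (s :- (:1 :+ y)) := s :- :1) refl y s) }

  sqrt : ∀ a → 0# ≤ a → Σ[ s ∈ Carrier ] IsSqrt a s
  sqrt a 0≤a = s , 0≤s , antisym s²≤a a≤s²
    where
    S : Carrier → Set
    S x = 0# ≤ x × x * x ≤ a

    lub : Σ[ s ∈ Carrier ] (IsUpperBound S s × (∀ {b} → IsUpperBound S b → s ≤ b))
    lub = supremum S (0# , ≤-refl , ≤-respˡ-≈ (sym (zeroʳ 0#)) 0≤a)
      -- The set is bounded by 1 + a because a ≤ (1 + a)².
      (1# + a , λ { {x} (0≤x , x²≤a) → square-cancel-≤ (+-pos-nonneg (+-pos-nonneg 0<1 0≤a) 0≤x)
        (≤-trans x²≤a (≤-by (1# + a + a * a) (+-nonneg (+-nonneg 0≤1 0≤a) (*-nonneg 0≤a 0≤a))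
          (solve 1 (λ a → a :+ (:1 :+ a :+ a :* a) := (:1 :+ a) :* (:1 :+ a)) refl a))) })
    s   = proj₁ lub
    0≤s : 0# ≤ s
    0≤s = proj₁ (proj₂ lub) (≤-refl , ≤-respˡ-≈ (sym (zeroʳ 0#)) 0≤a)

    -- Newton's step s − (s² − a)/2s overestimates √a.
    s²≤a : s * s ≤ a
    s²≤a with em {s * s ≤ a}
    ... | yes s²≤a = s²≤a
    ... | no ¬s²≤a = contradiction (proj₂ (proj₂ lub) bound)
                       (<⇒≱ (<-by e 0<e (solve 2 (λ s e → s :- e :+ e := s) refl s e)))
      where
      δ = s * s - a
      0<δ : 0# < δ
      0<δ = x<y⇒0<y-x (≰⇒> ¬s²≤a)
      0<s : 0# < s
      0<s = 0≤s , λ 0≈s → ¬s²≤a (≤-respˡ-≈ (trans (sym (zeroʳ 0#)) (*-cong 0≈s 0≈s)) 0≤a)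
      0<2s = *-pos 0<2 0<s
      e = δ * (2# * s) ⁻¹
      0<e = *-pos 0<δ (⁻¹-pos 0<2s)
      2se≈δ : 2# * s * e ≈ δ
      2se≈δ = begin
        2# * s * e
            ≈⟨ solve 3 (λ t d i → t :* (d :* i) := d :* (t :* i)) refl (2# * s) δ _ ⟩
        δ * (2# * s * (2# * s) ⁻¹)       ≈⟨ *-congˡ (*-inverseʳ (0<⇒≉0 0<2s)) ⟩
        δ * 1#                           ≈⟨ solve 1 (λ d → d :* :1 := d) refl δ ⟩
        δ                                ∎
      0<s-e : 0# < s - e
      0<s-e = *-cancelˡ-nonneg 0<2s (proj₁ 0<2s[s-e]) ,
        λ 0≈s-e → proj₂ 0<2s[s-e] (trans (sym (zeroʳ _)) (*-congˡ 0≈s-e))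
        where
        0<2s[s-e] : 0# < 2# * s * (s - e)
        0<2s[s-e] = <-respʳ-≈ (begin
          s * s + a
            ≈⟨ solve 2 (λ s a → s :* s :+ a := (:1 :+ :1) :* s :* s :- (s :* s :- a)) refl s a ⟩
          2# * s * s - δ          ≈⟨ +-congˡ (-‿cong 2se≈δ) ⟨
          2# * s * s - 2# * s * e
            ≈⟨ solve 3 (λ t s e → t :* s :- t :* e := t :* (s :- e)) refl (2# * s) s e ⟩
          2# * s * (s - e)        ∎) (+-pos-nonneg (*-pos 0<s 0<s) 0≤a)
      bound : IsUpperBound S (s - e)
      bound {x} (0≤x , x²≤a) = square-cancel-≤ (+-pos-nonneg 0<s-e 0≤x)
          (≤-trans x²≤a (≤-by (e * e) (0≤x*x e) (begin
        a + e * e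
            ≈⟨ solve 3 (λ s a e → a :+ e :* e := s :* s :- (s :* s :- a) :+ e :* e) refl s a e ⟩
        s * s - δ + e * e                   ≈⟨ +-congʳ (+-congˡ (-‿cong 2se≈δ)) ⟨
        s * s - 2# * s * e + e * e
            ≈⟨ solve 2 (λ s e → s :* s :- (:1 :+ :1) :* s :* e :+ e :* e := (s :- e) :* (s :- e)) refl s e ⟩
        (s - e) * (s - e)                   ∎)))

    a≤s² : a ≤ s * s
    a≤s² with em {a ≤ s * s}
    ... | yes a≤s² = a≤s²
    ... | no ¬a≤s² = contradiction (proj₁ (proj₂ lub) {s + e} (+-nonneg 0≤s (proj₁ 0<e) , [s+e]²≤a))
        (<⇒≱ (<-by e 0<e refl))
      where
      δ = a - s * s
      0<δ : 0# < δ
      0<δ = x<y⇒0<y-x (≰⇒> ¬a≤s²)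
      -- The summand δ of `k` forces the increment e = δ/k to be at most 1. Then 2se + e² ≤ (1 +
      -- 2s)e ≤ ke = δ, so s + e still lies in `S`.
      k = 1# + 2# * s + δ
      0<k : 0# < k
      0<k = +-pos-nonneg (+-pos-nonneg 0<1 (*-nonneg (proj₁ 0<2) 0≤s)) (proj₁ 0<δ)
      e = δ * k ⁻¹
      0<e = *-pos 0<δ (⁻¹-pos 0<k)
      ke≈δ : k * e ≈ δ
      ke≈δ = begin
        k * e              ≈⟨ solve 3 (λ t d i → t :* (d :* i) := d :* (t :* i)) refl k δ _ ⟩
        δ * (k * k ⁻¹)     ≈⟨ *-congˡ (*-inverseʳ (0<⇒≉0 0<k)) ⟩
        δ * 1#             ≈⟨ solve 1 (λ d → d :* :1 := d) refl δ ⟩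
        δ                  ∎
      e≤1 : e ≤ 1#
      e≤1 = *-cancelˡ-≤ 0<k (≤-respˡ-≈ (sym ke≈δ)
        (≤-by (1# + 2# * s) (+-nonneg 0≤1 (*-nonneg (proj₁ 0<2) 0≤s))
          (solve 2 (λ d s → d :+ (:1 :+ (:1 :+ :1) :* s) := (:1 :+ (:1 :+ :1) :* s :+ d) :* :1) refl δ s)))
      [s+e]²≤a : (s + e) * (s + e) ≤ a
      [s+e]²≤a = ≤-by (e * (1# - e) + δ * e)
        (+-nonneg (*-nonneg (proj₁ 0<e) (x≤y⇒0≤y-x e≤1)) (*-nonneg (proj₁ 0<δ) (proj₁ 0<e)))
        (begin
          (s + e) * (s + e) + (e * (1# - e) + δ * e)
            ≈⟨ solve 3 (λ s e d → (s :+ e) :* (s :+ e) :+ (e :* (:1 :- e) :+ d :* e) :=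
                          s :* s :+ (:1 :+ (:1 :+ :1) :* s :+ d) :* e) refl s e δ ⟩
          s * s + k * e                               ≈⟨ +-congˡ ke≈δ ⟩
          s * s + δ
              ≈⟨ solve 2 (λ s a → s :* s :+ (a :- s :* s) := a) refl s a ⟩
          a                                           ∎)

-- Finite operations on measurable sets.

module MeasurableSets (em : ExcludedMiddle 0ℓ) (ℝ : RealField) (X : Probability.MeasurableSpace ℝ) where
  open Probability.MeasurableSpace X
  open GraphOrientation em ℝ using (⟪_⟫)

  ∅-measurable : Measurable U.∅
  ∅-measurable = resp ((λ ¬⊤ → ¬⊤ _) , λ ()) (complement whole)

  ∪-measurable : ∀ {A B} → Measurable A → Measurable B → Measurable (A U.∪ B)
  ∪-measurable {A} {B} A-m B-m =
    resp ((λ { (zero , a) → inj₁ a ; (suc _ , b) → inj₂ b }) ,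
          λ { (inj₁ a) → 0 , a ; (inj₂ b) → 1 , b })
      (union {A = λ { zero → A ; (suc _) → B }} λ { zero → A-m ; (suc _) → B-m })

  ∩-measurable : ∀ {A B} → Measurable A → Measurable B → Measurable (A U.∩ B)
  ∩-measurable {A} {B} A-m B-m =
    resp ((λ {ω} ¬[¬a⊎¬b] → stable (¬[¬a⊎¬b] ∘ inj₁) , stable (¬[¬a⊎¬b] ∘ inj₂)) ,
          λ { (a , b) → [ (λ ¬a → ¬a a) , (λ ¬b → ¬b b) ]′ })
      (complement (∪-measurable (complement A-m) (complement B-m)))
    where
    stable : ∀ {P : Set} → ¬ ¬ P → P
    stable {P} ¬¬p with em {P}
    ... | yes p = p
    ... | no ¬p = ⊥-elim (¬¬p ¬p)

  ×-measurable : ∀ (P : Set) {A} → Measurable A → Measurable (λ ω → P × A ω)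
  ×-measurable P A-m with em {P}
  ... | yes p = resp ((p ,_) , proj₂) A-m
  ... | no ¬p = resp ((λ ()) , (¬p ∘ proj₁)) ∅-measurable

  ∃-measurable : ∀ {m} {A : Fin m → Pred Point 0ℓ} → (∀ i → Measurable (A i)) →
                 Measurable (λ ω → ∃ λ i → A i ω)
  ∃-measurable {zero}  _   = resp ((λ ()) , λ ()) ∅-measurable
  ∃-measurable {suc m} A-m =
    resp ([ zero ,_ , (λ (i , a) → suc i , a) ]′ ,
          λ { (zero , a) → inj₁ a ; (suc i , a) → inj₂ (i , a) })
      (∪-measurable (A-m zero) (∃-measurable (A-m ∘ suc)))

  -- Split on whether the event of coordinate zero occurs and absorb that bit into `P`. Since `P` is
  -- arbitrary, every function of a random subset built from finitely many events becomes
  -- measurable.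
  ⟪⟫-measurable : ∀ {m} {A : Fin m → Pred Point 0ℓ} → (∀ i → Measurable (A i)) →
                  (P : Pred (Subset m) 0ℓ) → Measurable (λ ω → P ⟪ (λ i → A i ω) ⟫)
  ⟪⟫-measurable {zero} _ P = resp (proj₁ , (_, _)) (×-measurable (P []) whole)
  ⟪⟫-measurable {suc m} {A} A-m P = resp (merge , split)
    (∪-measurable (∩-measurable (A-m zero) (rest inside))
                  (∩-measurable (complement (A-m zero)) (rest outside)))
    where
    tail : Point → Subset m
    tail ω = ⟪ (λ i → A (suc i) ω) ⟫

    rest : ∀ b → Measurable (λ ω → P (b ∷ tail ω))
    rest b = ⟪⟫-measurable (A-m ∘ suc) (λ S → P (b ∷ S))

    merge : ∀ {ω} → (A zero ω × P (inside ∷ tail ω)) ⊎ (¬ A zero ω × P (outside ∷ tail ω)) →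
            P ⟪ (λ i → A i ω) ⟫
    merge {ω} pieces with em {A zero ω} | pieces
    ... | yes _ | inj₁ (_ , p)  = p
    ... | yes a | inj₂ (¬a , _) = contradiction a ¬a
    ... | no ¬a | inj₁ (a , _)  = contradiction a ¬a
    ... | no _  | inj₂ (_ , p)  = p

    split : ∀ {ω} → P ⟪ (λ i → A i ω) ⟫ →
            (A zero ω × P (inside ∷ tail ω)) ⊎ (¬ A zero ω × P (outside ∷ tail ω))
    split {ω} p with em {A zero ω}
    ... | yes a = inj₁ (a , p)
    ... | no ¬a = inj₂ (¬a , p)

-- Open intervals are Borel.

module BorelSets (em : ExcludedMiddle 0ℓ) (ℝ : RealField) where
  open RealField ℝ
  open Probability ℝ
  open OrderedField ℝ
  open Classical em ℝ
  open CommutativeRing commutativeRing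
    using (refl; sym; trans; semiring)
  open IntegerCoefficients commutativeRing
  open MeasurableSets em ℝ borel
  open Multiples semiring using (1+×) renaming (_×_ to _⨯_)

  -- The generators are closed half-lines, so the open ray is exhausted by those ending at b - 1/(n
  -- + 1).
  open-ray-measurable : ∀ b → IsBorel (_< b)
  open-ray-measurable b = resp (below , above) (union (λ n → halfLine (b - (1# + n ⨯ 1#) ⁻¹)))
    where
    0≤n : ∀ n → 0# ≤ n ⨯ 1#
    0≤n zero    = ≤-refl
    0≤n (suc n) = ≤-respʳ-≈ (sym (1+× n 1#)) (+-nonneg 0≤1 (0≤n n))

    0<1+n : ∀ n → 0# < 1# + n ⨯ 1#
    0<1+n n = +-pos-nonneg 0<1 (0≤n n)

    below : ∀ {x} → (∃ λ n → x ≤ b - (1# + n ⨯ 1#) ⁻¹) → x < b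
    below (n , x≤) = ≤-<-trans x≤ (<-by i (⁻¹-pos (0<1+n n)) (solve 2 (λ b i → b :- i :+ i := b) refl b i))
      where i = (1# + n ⨯ 1#) ⁻¹

    above : ∀ {x} → x < b → ∃ λ n → x ≤ b - (1# + n ⨯ 1#) ⁻¹
    above {x} x<b = n , ≤-by (b - x - i)
        (x≤y⇒0≤y-x (*-cancelˡ-≤ (0<1+n n) (≤-respˡ-≈ (sym (*-inverseʳ (0<⇒≉0 (0<1+n n)))) 1≤me)))
        (solve 3 (λ b x i → x :+ (b :- x :- i) := b :- i) refl b x i)
      where
      e = b - x
      0<e = x<y⇒0<y-x x<b
      -- An `n` above 1/(b - x) makes 1/(n + 1) at most b - x.
      n = proj₁ (archimedean (e ⁻¹))
      m = 1# + n ⨯ 1#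
      i = m ⁻¹
      e⁻¹≤m : e ⁻¹ ≤ m
      e⁻¹≤m = ≤-trans (proj₁ (proj₂ (archimedean (e ⁻¹))))
          (≤-by 1# 0≤1 (solve 1 (λ n → n :+ :1 := :1 :+ n) refl (n ⨯ 1#)))
      1≤me : 1# ≤ m * e
      1≤me = ≤-respˡ-≈ (trans (solve 2 (λ i e → i :* e := e :* i) refl (e ⁻¹) e) (*-inverseʳ (0<⇒≉0 0<e)))
        (*-monoʳ-≤ (proj₁ 0<e) e⁻¹≤m)

  interval-measurable : ∀ a b → IsBorel ⟨ a , b ⟩
  interval-measurable a b = ∩-measurable
    (resp (≰⇒> , <⇒≱) (complement (halfLine a))) (open-ray-measurable b)

-- Finite additivity and random variables with finitely many values.

module FiniteProbability (em : ExcludedMiddle 0ℓ) (ℝ : RealField) {X : Probability.MeasurableSpace ℝ}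
                         (μ : Probability.ProbabilityMeasure ℝ X) where
  open RealField ℝ
  open Probability ℝ using (prob)
  open Probability.ProbabilityMeasure μ hiding (prob)
  open Probability.MeasurableSpace X
  open MeasurableSets em ℝ X
  open OrderedField ℝ
  open Classical em ℝ
  open GraphOrientation em ℝ using (subsets; weight)
  open CommutativeRing commutativeRing
    using (refl; sym; trans; +-congˡ; +-congʳ; *-congˡ; *-congʳ; +-identityʳ; zeroˡ; zeroʳ; semiring)
  open SemiringSum semiring using (sum-cong-≋; sum-replicate-zero; ∑-comm; *-distribˡ-sum; *-distribʳ-sum)
  open IntegerCoefficients commutativeRing

  ℙ : Pred Point 0ℓ → Carrier
  ℙ = prob μ

  -- For the constant sequence of empty sets, two consecutive partial sums differ by p, and both lie
  -- within ε/2 of the limit. Hence p ≤ ε for every ε.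
  ℙ-∅ : ℙ U.∅ ≈ 0#
  ℙ-∅ = antisym (≤-limit small) (prob-nonneg ∅-measurable)
    where
    open ≈-Reasoning
    p = ℙ U.∅
    small : ∀ ε → 0# < ε → p ≤ 0# + ε
    small ε 0<ε with N , close ← σ-additive {A = λ _ → U.∅} (λ _ → ∅-measurable) (λ _ ()) (½ * ε)
        (*-pos 0<½ 0<ε) =
      ≤-by (s + l) (+-nonneg (x≤y⇒0≤y-x (proj₁ (proj₁ (close N ℕₚ.≤-refl))))
                             (x≤y⇒0≤y-x (proj₁ (proj₂ (close (suc N) (ℕₚ.n≤1+n N))))))
        (begin
          p + (s + l)
            ≈⟨ solve 5 (λ p S L h ε → p :+ ((S :- (L :- h :* ε)) :+ (L :+ h :* ε :- (p :+ S))) :=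
                          (h :+ h) :* ε) refl p S _ ½ ε ⟩
          (½ + ½) * ε       ≈⟨ trans (*-congʳ ½+½≈1) (solve 1 (λ ε → :1 :* ε := :0 :+ ε) refl ε) ⟩
          0# + ε            ∎)
      where
      S = sum {N} (λ _ → p)
      L = ℙ (U.⋃ ℕ (λ _ → U.∅))
      s = S - (L - ½ * ε)
      l = L + ½ * ε - (p + S)

  -- Pad the two sets with empty ones. From index 2 on the partial sums are constant, so the limit
  -- is that constant; index 2 + N is past both nonempty terms and past the threshold `N`.
  ℙ-additive : ∀ {A B} → Measurable A → Measurable B → (∀ {ω} → A ω → ¬ B ω) →
               ℙ (A U.∪ B) ≈ ℙ A + ℙ B
  ℙ-additive {A} {B} A-m B-m disjoint = antisym
      (≤-limit λ ε 0<ε → ≤-by (ℙ A + ℙ B - (ℙ (A U.∪ B) - ε)) (x≤y⇒0≤y-x (proj₁ (proj₁ (close ε 0<ε))))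
        (solve 3 (λ s L ε → L :+ (s :- (L :- ε)) := s :+ ε) refl (ℙ A + ℙ B) _ ε))
      (≤-limit λ ε 0<ε → proj₁ (proj₂ (close ε 0<ε)))
    where
    C : ℕ → Pred Point 0ℓ
    C 0 = A
    C 1 = B
    C (suc (suc _)) = U.∅
    C-m : ∀ i → Measurable (C i)
    C-m 0 = A-m
    C-m 1 = B-m
    C-m (suc (suc _)) = ∅-measurable
    C-disjoint : ∀ {i j} → ¬ i ≡ j → ∀ {ω} → C i ω → ¬ C j ω
    C-disjoint {0} {0} i≢j = contradiction ≡.refl i≢j
    C-disjoint {0} {1} i≢j = disjoint
    C-disjoint {1} {0} i≢j b a = disjoint a b
    C-disjoint {1} {1} i≢j = contradiction ≡.refl i≢j
    C-disjoint {0} {suc (suc _)} i≢j _ ()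
    C-disjoint {1} {suc (suc _)} i≢j _ ()
    ⋃C≐A∪B : U.⋃ ℕ C ≐ (A U.∪ B)
    ⋃C≐A∪B = (λ { (0 , a) → inj₁ a ; (1 , b) → inj₂ b ; (suc (suc _) , ()) }) ,
             λ { (inj₁ a) → 0 , a ; (inj₂ b) → 1 , b }
    L≈ : ℙ (U.⋃ ℕ C) ≈ ℙ (A U.∪ B)
    L≈ = prob-cong ⋃C≐A∪B (union C-m)
    partial : ∀ N → sum {suc (suc N)} (λ i → ℙ (C (toℕ i))) ≈ ℙ A + ℙ B
    partial N = +-congˡ (trans (+-congˡ (trans (sum-cong-≋ {N} (λ _ → ℙ-∅)) (sum-replicate-zero N)))
        (+-identityʳ _))
    close : ∀ ε → 0# < ε → ℙ (A U.∪ B) - ε < ℙ A + ℙ B × ℙ A + ℙ B < ℙ (A U.∪ B) + ε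
    close ε 0<ε with N , near ← σ-additive C-m (λ {i} {j} → C-disjoint {i} {j}) ε 0<ε
                with lo , hi ← near (2 ℕ.+ N) (ℕₚ.m≤n+m N 2) =
      <-respˡ-≈ (+-congʳ L≈) (<-respʳ-≈ (partial N) lo) ,
      <-respʳ-≈ (+-congʳ L≈) (<-respˡ-≈ (partial N) hi)

  private
    ℙ-∪-split : ∀ {A B} → Measurable A → Measurable B →
                ℙ (A U.∪ B) ≈ ℙ A + ℙ (B U.∩ U.∁ A)
    ℙ-∪-split {A} {B} A-m B-m =
      trans (prob-cong (to , [ inj₁ , inj₂ ∘ proj₁ ]′) (∪-measurable A-m B-m))
            (ℙ-additive A-m (∩-measurable B-m (complement A-m)) (λ a (_ , ¬a) → ¬a a))
      where
      to : ∀ {ω} → A ω ⊎ B ω → A ω ⊎ (B ω × ¬ A ω)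
      to (inj₁ a) = inj₁ a
      to {ω} (inj₂ b) with em {A ω}
      ... | yes a = inj₁ a
      ... | no ¬a = inj₂ (b , ¬a)

  ℙ-mono : ∀ {A B} → Measurable A → Measurable B → A U.⊆ B → ℙ A ≤ ℙ B
  ℙ-mono {A} {B} A-m B-m A⊆B = ≤-by (ℙ (B U.∩ U.∁ A)) (prob-nonneg (∩-measurable B-m (complement A-m)))
    (sym (trans (prob-cong (inj₂ , [ A⊆B , (λ b → b) ]′) B-m) (ℙ-∪-split A-m B-m)))

  ℙ-∪-≤ : ∀ {A B} → Measurable A → Measurable B → ℙ (A U.∪ B) ≤ ℙ A + ℙ B
  ℙ-∪-≤ A-m B-m = ≤-respˡ-≈ (sym (ℙ-∪-split A-m B-m))
    (+-mono-≤ ≤-refl (ℙ-mono (∩-measurable B-m (complement A-m)) B-m proj₁))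

  ℙ-certain : ∀ {A} → (∀ ω → A ω) → ℙ A ≈ 1#
  ℙ-certain a = trans (sym (prob-cong ((λ {ω} _ → a ω) , _) whole)) prob-whole

  -- Asked of every predicate on the values, so that joint events such as `T ω ≡ x × P (T ω)` are
  -- measurable without being decomposed into fibres.
  Discrete : ∀ {S : Set} → (Point → S) → Set₁
  Discrete {S} T = ∀ (P : Pred S 0ℓ) → Measurable (P ∘ T)

  -- Induction on the list; uniqueness makes the fibre of the head disjoint from the fibres of the
  -- tail.
  ℙ-fibres : ∀ {S : Set} {T : Point → S} → Discrete T → ∀ (P : Pred S 0ℓ) {xs} → Unique xs →
             sum (λ i → ℙ (λ ω → T ω ≡ lookup xs i × P (T ω))) ≈ ℙ (λ ω → T ω ∈ xs × P (T ω))
  ℙ-fibres T-m P [] = trans (sym ℙ-∅) (prob-cong ((λ ()) , λ ()) ∅-measurable)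
  ℙ-fibres {T = T} T-m P {x ∷ xs} (x∉xs ∷ xs!) =
    trans (+-congˡ (ℙ-fibres T-m P xs!))
      (trans (sym (ℙ-additive (T-m (λ s → s ≡ x × P s)) (T-m (λ s → s ∈ xs × P s))
               λ { (≡.refl , _) (Tω∈xs , _) → All.lookup x∉xs Tω∈xs ≡.refl }))
        (prob-cong ((λ { (inj₁ (eq , p)) → here eq , p ; (inj₂ (Tω∈xs , p)) → there Tω∈xs , p }) ,
                    λ { (here eq , p) → inj₁ (eq , p) ; (there Tω∈xs , p) → inj₂ (Tω∈xs , p) })
          (T-m (λ s → (s ≡ x × P s) ⊎ (s ∈ xs × P s)))))

  ∈-subsets : ∀ {n} (S : Subset n) → S ∈ subsets n
  ∈-subsets [] = here ≡.refl
  ∈-subsets (inside ∷ S)  = ∈-++⁺ˡ (∈-map⁺ (inside ∷_) (∈-subsets S))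
  ∈-subsets (outside ∷ S) = ∈-++⁺ʳ _ (∈-map⁺ (outside ∷_) (∈-subsets S))

  subsets-unique : ∀ n → Unique (subsets n)
  subsets-unique zero    = All.[] ∷ []
  subsets-unique (suc n) = ++⁺ (map⁺ ∷-injectiveʳ (subsets-unique n))
      (map⁺ ∷-injectiveʳ (subsets-unique n)) disjoint
    where
    disjoint : ∀ {S} → ¬ (S ∈ map (inside ∷_) (subsets n) × S ∈ map (outside ∷_) (subsets n))
    disjoint (∈in , ∈out) with ∈-map⁻ _ ∈in | ∈-map⁻ _ ∈out
    ... | _ , _ , ≡.refl | _ , _ , ()

  module _ {n} {T : Point → Subset n} (T-m : Discrete T) where

    ℙ-marginal : ∀ (P : Pred (Subset n) 0ℓ) →
                 sum (λ i → ℙ (λ ω → T ω ≡ lookup (subsets n) i × P (T ω))) ≈ ℙ (P ∘ T)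
    ℙ-marginal P = trans (ℙ-fibres T-m P (subsets-unique n))
      (prob-cong (proj₂ , (∈-subsets _ ,_)) (T-m (λ S → S ∈ subsets n × P S)))

    -- Linearity of expectation: once the sums are exchanged, `c v` is multiplied by the total
    -- probability of the fibres containing `v`. From here on only the marginals of single vertices
    -- matter.
    expected-weight : ∀ c →
      sum (λ i → weight c (lookup (subsets n) i) * ℙ (λ ω → T ω ≡ lookup (subsets n) i))
      ≈ sum (λ v → c v * ℙ (λ ω → v ∈ˢ T ω))
    expected-weight c = begin
      sum (λ i → weight c (S i) * p i)
          ≈⟨ sum-cong-≋ (λ i → *-distribʳ-sum (p i) (λ v → if does (v ∈ˢ? S i) then c v else 0#)) ⟩
      sum (λ i → sum (λ v → (if does (v ∈ˢ? S i) then c v else 0#) * p i))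
          ≈⟨ ∑-comm (λ i v → (if does (v ∈ˢ? S i) then c v else 0#) * p i) ⟩
      sum (λ v → sum (λ i → (if does (v ∈ˢ? S i) then c v else 0#) * p i))
          ≈⟨ sum-cong-≋ (λ v → trans (sum-cong-≋ (restrict v)) (sym (*-distribˡ-sum (c v) (joint v)))) ⟩
      sum (λ v → c v * sum (joint v))
          ≈⟨ sum-cong-≋ (λ v → *-congˡ (ℙ-marginal (v ∈ˢ_))) ⟩
      sum (λ v → c v * ℙ (λ ω → v ∈ˢ T ω))                               ∎
      where
      open ≈-Reasoning
      S : Fin (length (subsets n)) → Subset n
      S = lookup (subsets n)
      p : Fin (length (subsets n)) → Carrier
      p i = ℙ (λ ω → T ω ≡ S i)
      joint : Fin n → Fin (length (subsets n)) → Carrier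
      joint v i = ℙ (λ ω → T ω ≡ S i × v ∈ˢ T ω)
      restrict : ∀ v i → (if does (v ∈ˢ? S i) then c v else 0#) * p i ≈ c v * joint v i
      restrict v i with v ∈ˢ? S i
      ... | yes v∈S = *-congˡ (prob-cong ((λ eq → eq , ≡.subst (v ∈ˢ_) (≡.sym eq) v∈S) , proj₁)
          (T-m (_≡ S i)))
      ... | no v∉S = trans (zeroˡ _) (sym (trans (*-congˡ (trans
              (prob-cong ((λ { (eq , v∈T) → v∉S (≡.subst (v ∈ˢ_) eq v∈T) }) , λ ())
                  (T-m (λ U → U ≡ S i × v ∈ˢ U))) ℙ-∅)) (zeroʳ _)))

-- Linear systems with fewer equations than unknowns.

module LinearAlgebra (em : ExcludedMiddle 0ℓ) (ℝ : RealField) where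
  open RealField ℝ
  open OrderedField ℝ
  open CommutativeRing commutativeRing
    using (refl; sym; trans; reflexive; +-cong; +-congˡ; *-congˡ; *-congʳ; -‿cong; +-identityˡ;
        +-identityʳ; zeroʳ; semiring)
  open SemiringSum semiring using (sum-cong-≋; sum-replicate-zero; sum-remove)
  open IntegerCoefficients commutativeRing

  sum-zero : ∀ {n} {f : Fin n → Carrier} → (∀ i → f i ≈ 0#) → sum f ≈ 0#
  sum-zero {n} f≈0 = trans (sum-cong-≋ f≈0) (sum-replicate-zero n)

  sum-single : ∀ {n} {f : Fin n → Carrier} j → (∀ i → i ≢ j → f i ≈ 0#) → sum f ≈ f j
  sum-single zero    f≈0 = trans (+-congˡ (sum-zero (λ i → f≈0 (suc i) λ ()))) (+-identityʳ _)
  sum-single (suc j) f≈0 = trans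
    (+-cong (f≈0 zero λ ()) (sum-single j (λ i i≢j → f≈0 (suc i) λ { ≡.refl → i≢j ≡.refl })))
    (+-identityˡ _)

  sum-linear : ∀ {n} k (f g : Fin n → Carrier) → sum (λ i → f i + k * g i) ≈ sum f + k * sum g
  sum-linear {zero}  k f g = solve 1 (λ k → :0 := :0 :+ k :* :0) refl k
  sum-linear {suc n} k f g = trans (+-congˡ (sum-linear k (f ∘ suc) (g ∘ suc)))
    (solve 5 (λ k a b s t → a :+ k :* b :+ (s :+ k :* t) := a :+ s :+ k :* (b :+ t)) refl
      k (f zero) (g zero) (sum (f ∘ suc)) (sum (g ∘ suc)))

  -- Gaussian elimination on the equations indexed by `T`. An equation outside `T` or with zero
  -- coefficients is dropped; any other one has a pivot and eliminates one unknown together with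
  -- itself, which keeps the count strict.
  homogeneous-solution : ∀ {n m} (A : Fin n → Fin m → Carrier) (T : Subset n) → ∣ T ∣ ℕ.< m →
    Σ[ t ∈ (Fin m → Carrier) ] (∃ λ i → ¬ t i ≈ 0#) × (∀ w → w ∈ˢ T → sum (λ i → t i * A w i) ≈ 0#)
  homogeneous-solution {m = suc m} A [] _ = (λ _ → 1#) , (zero , λ 1≈0 → 0≉1 (sym 1≈0)) , λ ()
  homogeneous-solution A (outside ∷ T) ∣T∣<m with t , t≉0 , zeros ← homogeneous-solution (A ∘ suc) T ∣T∣<m =
    t , t≉0 , λ { (suc w) w∈T → zeros w (drop-there w∈T) }
  homogeneous-solution {m = suc m} A (inside ∷ T) (ℕ.s≤s ∣T∣<m) with em {∃ λ p → ¬ A zero p ≈ 0#}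
  ... | no ∄p with t , t≉0 , zeros ← homogeneous-solution (A ∘ suc) T (ℕₚ.m<n⇒m<1+n ∣T∣<m) =
    t , t≉0 , λ { zero _ → sum-zero (λ i → trans (*-congˡ (A₀≈0 i)) (zeroʳ (t i)))
                ; (suc w) w∈T → zeros w (drop-there w∈T) }
    where
    A₀≈0 : ∀ i → A zero i ≈ 0#
    A₀≈0 i with em {A zero i ≈ 0#}
    ... | yes A₀≈0 = A₀≈0
    ... | no A₀≉0 = contradiction (i , A₀≉0) ∄p
  ... | yes (p , a≉0) =
    t , (punchIn p (proj₁ t′≉0) , λ t≈0 → proj₂ t′≉0 (trans (sym (t-punchIn _)) t≈0)) , zeros
    where
    a = A zero p
    b : Fin m → Carrier
    b = A zero ∘ punchIn p
    eliminated =
      homogeneous-solution (λ w i → A (suc w) (punchIn p i) + - (A (suc w) p * a ⁻¹) * b i) T ∣T∣<m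
    t′ = proj₁ eliminated
    t′≉0 = proj₁ (proj₂ eliminated)
    σ : Fin (suc _) → Carrier
    σ w = sum (λ i → t′ i * A w (punchIn p i))
    t : Fin (suc m) → Carrier
    -- The value of the pivot unknown is the one that solves equation zero.
    t = insertAt t′ p (- (a ⁻¹ * σ zero))
    t-p : t p ≈ - (a ⁻¹ * σ zero)
    t-p = reflexive (insertAt-lookup t′ p _)
    t-punchIn : ∀ i → t (punchIn p i) ≈ t′ i
    t-punchIn i = reflexive (insertAt-punchIn t′ p _ i)
    expand : ∀ w → sum (λ i → t i * A w i) ≈ - (a ⁻¹ * σ zero) * A w p + σ w
    expand w = trans (sum-remove {i = p} (λ i → t i * A w i))
      (+-cong (*-congʳ t-p) (sum-cong-≋ (λ i → *-congʳ (t-punchIn i))))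
    open ≈-Reasoning
    zeros : ∀ w → w ∈ˢ (inside ∷ T) → sum (λ i → t i * A w i) ≈ 0#
    zeros zero _ = begin
      sum (λ i → t i * A zero i)           ≈⟨ expand zero ⟩
      - (a ⁻¹ * σ zero) * a + σ zero
          ≈⟨ solve 3 (λ a i s → :- (i :* s) :* a :+ s := s :- a :* i :* s) refl a (a ⁻¹) (σ zero) ⟩
      σ zero - a * a ⁻¹ * σ zero           ≈⟨ +-congˡ (-‿cong (*-congʳ (*-inverseʳ a≉0))) ⟩
      σ zero - 1# * σ zero                 ≈⟨ solve 1 (λ s → s :- :1 :* s := :0) refl (σ zero) ⟩
      0#                                   ∎
    zeros (suc w) w∈T = begin
      sum (λ i → t i * A (suc w) i)                         ≈⟨ expand (suc w) ⟩
      - (a ⁻¹ * σ zero) * c + σ (suc w)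
          ≈⟨ solve 4 (λ c i s s′ → :- (i :* s) :* c :+ s′ := s′ :+ :- (c :* i) :* s)
          refl c (a ⁻¹) (σ zero) (σ (suc w)) ⟩
      σ (suc w) + - (c * a ⁻¹) * σ zero
          ≈⟨ sum-linear (- (c * a ⁻¹)) (λ i → t′ i * A (suc w) (punchIn p i)) (λ i → t′ i * b i) ⟨
      sum (λ i → t′ i * A (suc w) (punchIn p i) + - (c * a ⁻¹) * (t′ i * b i))
        ≈⟨ sum-cong-≋ (λ i → solve 4 (λ t x k b → t :* x :+ k :* (t :* b) := t :* (x :+ k :* b))
            refl (t′ i) (A (suc w) (punchIn p i)) _ (b i)) ⟩
      sum (λ i → t′ i * (A (suc w) (punchIn p i) + - (c * a ⁻¹) * b i))
          ≈⟨ proj₂ (proj₂ eliminated) w (drop-there w∈T) ⟩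
      0#                                                    ∎
      where c = A (suc w) p

-- Basic solutions of the vertex cover LP are half-integral.

module HalfIntegrality (em : ExcludedMiddle 0ℓ) (ℝ : RealField) where
  open RealField ℝ
  open OrderedField ℝ
  open LinearAlgebra em ℝ
  open GraphOrientation em ℝ
  open CommutativeRing commutativeRing
    using (refl; sym; trans; +-cong; +-congˡ; +-congʳ; *-congˡ; *-congʳ; -‿cong; +-identityˡ; *-identityˡ;
        zeroˡ; zeroʳ; semiring)
  open SemiringSum semiring using (sum-cong-≋; ∑-comm; ∑-distrib-+; *-distribˡ-sum; *-distribʳ-sum)
  open IntegerCoefficients commutativeRing

  HalfIntegral : Carrier → Set
  HalfIntegral x = x ≈ 0# ⊎ x ≈ ½ ⊎ x ≈ 1#

  private
    difference : ∀ {x y z} → x + y ≈ z → y ≈ z - x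
    difference {x} {y} x+y≈z = trans (solve 2 (λ x y → y := x :+ y :- x) refl x y) (+-congʳ x+y≈z)

  HalfIntegral-complement : ∀ {x y} → x + y ≈ 1# → HalfIntegral x → HalfIntegral y
  HalfIntegral-complement x+y≈1 (inj₁ x≈0) =
    inj₂ (inj₂ (trans (sym (+-identityˡ _)) (trans (+-congʳ (sym x≈0)) x+y≈1)))
  HalfIntegral-complement x+y≈1 (inj₂ (inj₁ x≈½)) = inj₂ (inj₁ (trans (difference x+y≈1)
    (trans (+-cong (sym ½+½≈1) (-‿cong x≈½)) (solve 1 (λ h → h :+ h :- h := h) refl ½))))
  HalfIntegral-complement x+y≈1 (inj₂ (inj₂ x≈1)) = inj₁ (trans (difference x+y≈1)
    (trans (+-congˡ (-‿cong x≈1)) (solve 0 (:1 :- :1 := :0) refl)))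

  -- Moving x along drift in either direction keeps all active constraints
  -- active, so drift must vanish at a basic solution.
  drift : Carrier → Carrier
  drift x with em {HalfIntegral x} | em {x ≤ ½}
  ... | yes _ | _     = 0#
  ... | no  _ | yes _ = - 1#
  ... | no  _ | no  _ = 1#

  drift-zero : ∀ {x} → x ≈ 0# → drift x ≈ 0#
  drift-zero {x} x≈0 with em {HalfIntegral x} | em {x ≤ ½}
  ... | yes _ | _ = refl
  ... | no ¬h | _ = contradiction (inj₁ x≈0) ¬h

  drift≈0⇒HalfIntegral : ∀ {x} → drift x ≈ 0# → HalfIntegral x
  drift≈0⇒HalfIntegral {x} drift≈0 with em {HalfIntegral x} | em {x ≤ ½}
  ... | yes h | _     = h
  ... | no _  | yes _ = contradiction
    (trans (solve 0 (:0 := :- :0) refl) (trans (-‿cong (sym drift≈0)) (solve 0 (:- (:- :1) := :1) refl)))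
    0≉1
  ... | no _  | no _  = contradiction (sym drift≈0) 0≉1

  -- The endpoints of a tight edge are either both half-integral, with no drift, or strictly on
  -- opposite sides of ½, with opposite drifts.
  drift-antisym : ∀ {x y} → x + y ≈ 1# → drift x + drift y ≈ 0#
  drift-antisym {x} {y} x+y≈1 with em {HalfIntegral x} | em {x ≤ ½} | em {HalfIntegral y} | em {y ≤ ½}
  ... | yes _ | _ | yes _ | _ = +-identityˡ 0#
  ... | yes h | _ | no ¬h | _ = contradiction (HalfIntegral-complement x+y≈1 h) ¬h
  ... | no ¬h | _ | yes h | _ = contradiction
      (HalfIntegral-complement (trans (solve 2 (λ x y → x :+ y := y :+ x) refl y x) x+y≈1) h) ¬h
  ... | no ¬h | yes x≤½ | no _ | yes y≤½ = contradiction (inj₂ (inj₁ (antisym x≤½ ½≤x))) ¬h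
    where
    ½≤x : ½ ≤ x
    ½≤x = ≤-by (½ - y) (x≤y⇒0≤y-x y≤½) (trans (solve 2 (λ h y → h :+ (h :- y) := h :+ h :- y) refl ½ y)
      (trans (+-congʳ (trans ½+½≈1 (sym x+y≈1))) (solve 2 (λ x y → x :+ y :- y := x) refl x y)))
  ... | no _ | yes _ | no _ | no _ = solve 0 (:- :1 :+ :1 := :0) refl
  ... | no _ | no _ | no _ | yes _ = solve 0 (:1 :+ :- :1 := :0) refl
  ... | no _ | no x≰½ | no _ | no y≰½ = contradiction
    (<-trans (<-by (x - ½) (x<y⇒0<y-x (≰⇒> x≰½)) refl)
      (<-by (y - ½) (x<y⇒0<y-x (≰⇒> y≰½)) (trans
        (solve 3 (λ x y h → h :+ h :+ (x :- h) :+ (y :- h) := x :+ y) refl x y ½)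
        (trans x+y≈1 (sym ½+½≈1)))))
    <-irrefl

  module _ {n} (G : Graph n) (c : Fin n → Carrier) (S : Subset n) where
    open VertexCoverLP G c S

    unit-coordinate : ∀ v (δ : Fin n → Carrier) → sum (λ w → unit v w * δ w) ≈ δ v
    unit-coordinate v δ = trans (sum-single v off-diagonal) on-diagonal
      where
      off-diagonal : ∀ w → w ≢ v → unit v w * δ w ≈ 0#
      off-diagonal w w≢v with v ≟ w
      ... | yes v≡w = contradiction (≡.sym v≡w) w≢v
      ... | no  _   = zeroˡ _
      on-diagonal : unit v v * δ v ≈ δ v
      on-diagonal with v ≟ v
      ... | yes _  = *-identityˡ _
      ... | no v≢v = contradiction ≡.refl v≢v

    row-applied : ∀ k (δ : Fin n → Carrier) → sum (λ w → row k w * δ w) ≈ lhs k δ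
    row-applied (nonneg {v} _) δ = unit-coordinate v δ
    row-applied (edge {u} {v} _ _ _) δ = trans
      (sum-cong-≋ (λ w →
        solve 3 (λ a b d → (a :+ b) :* d := a :* d :+ b :* d) refl (unit u w) (unit v w) (δ w)))
      (trans (∑-distrib-+ (λ w → unit u w * δ w) _) (+-cong (unit-coordinate u δ) (unit-coordinate v δ)))

    unit-outside : ∀ {v w} → v ∈ˢ S → w ∉ˢ S → unit v w ≈ 0#
    unit-outside {v} {w} v∈S w∉S with v ≟ w
    ... | yes ≡.refl = contradiction v∈S w∉S
    ... | no _ = refl

    row-outside : ∀ k {w} → w ∉ˢ S → row k w ≈ 0#
    row-outside (nonneg v∈S) w∉S = unit-outside v∈S w∉S
    row-outside (edge u∈S v∈S _) w∉S =
      trans (+-cong (unit-outside u∈S w∉S) (unit-outside v∈S w∉S)) (+-identityˡ 0#)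

    -- Suppose `δ j` is nonzero. There are ∣S∣ rows but only ∣S∣ - 1 columns in `S` other than `j`,
    -- so some nontrivial combination b of the rows vanishes on all of these. It also vanishes
    -- outside `S`, so pairing it with `δ` gives δ j · b j = 0. Then b is zero altogether, against
    -- independence.
    independent-rows-determine : (k : Fin ∣ S ∣ → Constraint) → LinearlyIndependent (row ∘ k) →
      (δ : Fin n → Carrier) → (∀ i → lhs (k i) δ ≈ 0#) → ∀ {j} → j ∈ˢ S → δ j ≈ 0#
    independent-rows-determine k independent δ kδ≈0 {j} j∈S with em {δ j ≈ 0#}
    ... | yes δj≈0 = δj≈0
    ... | no δj≉0
      with t , (i , ti≉0) , zeros ← homogeneous-solution (λ w i → row (k i) w) (S -ˢ j)
          (x∈p⇒∣p-x∣<∣p∣ j∈S) =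
        contradiction (independent t b≈0 i) ti≉0
      where
      b : Fin n → Carrier
      b w = sum (λ i → t i * row (k i) w)
      b≈0-off : ∀ w → w ≢ j → b w ≈ 0#
      b≈0-off w w≢j with w ∈ˢ? S
      ... | yes w∈S = zeros w (x∈p∧x≢y⇒x∈p-y w∈S w≢j)
      ... | no  w∉S = sum-zero (λ i → trans (*-congˡ (row-outside (k i) w∉S)) (zeroʳ _))
      open ≈-Reasoning
      δj*bj≈0 : δ j * b j ≈ 0#
      δj*bj≈0 = begin
        δ j * b j
            ≈⟨ solve 2 (λ x y → x :* y := y :* x) refl (δ j) (b j) ⟩
        b j * δ j
            ≈⟨ sum-single j (λ w w≢j → trans (*-congʳ (b≈0-off w w≢j)) (zeroˡ _)) ⟨
        sum (λ w → b w * δ w)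
            ≈⟨ sum-cong-≋ (λ w → *-distribʳ-sum (δ w) (λ i → t i * row (k i) w)) ⟩
        sum (λ w → sum (λ i → t i * row (k i) w * δ w))    ≈⟨ ∑-comm (λ w i → t i * row (k i) w * δ w) ⟩
        sum (λ i → sum (λ w → t i * row (k i) w * δ w))
            ≈⟨ sum-zero (λ i → trans
                 (sum-cong-≋ (λ w →
                   solve 3 (λ a b c → a :* b :* c := a :* (b :* c)) refl (t i) (row (k i) w) (δ w)))
                 (trans (sym (*-distribˡ-sum (t i) (λ w → row (k i) w * δ w)))
                        (trans (*-congˡ (trans (row-applied (k i) δ) (kδ≈0 i))) (zeroʳ _)))) ⟩
        0#                                                 ∎
      b≈0 : ∀ w → b w ≈ 0#
      b≈0 w with w ≟ j
      ... | yes ≡.refl = *-cancelˡ-0 δj≉0 δj*bj≈0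
      ... | no w≢j = b≈0-off w w≢j

    basic⇒half-integral : ∀ {x} → IsBasic x → ∀ {v} → v ∈ˢ S → HalfIntegral (x v)
    basic⇒half-integral {x} (k , active , independent) v∈S = drift≈0⇒HalfIntegral
      (independent-rows-determine k independent (drift ∘ x) (λ i → stays-active (k i) (active i)) v∈S)
      where
      stays-active : ∀ k → lhs k x ≈ rhs k → lhs k (drift ∘ x) ≈ 0#
      stays-active (edge _ _ _) tight = drift-antisym tight
      stays-active (nonneg _)   tight = drift-zero tight

-- Feasible query sets are the vertex covers containing all mandatory vertices.

module QuerySets (em : ExcludedMiddle 0ℓ) (ℝ : RealField) {n} (I : GraphOrientation.Instance em ℝ n) where
  open RealField ℝ
  open OrderedField ℝ
  open GraphOrientation em ℝ
  open GraphOrientation.Instance I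
  open CommutativeRing commutativeRing using (sym; trans; reflexive)
  open import Data.List.Extrema totalOrder using (argmin; argmin-all)

  ∈⟪⟫⁺ : ∀ {m} {A : Pred (Fin m) 0ℓ} {v} → A v → v ∈ˢ ⟪ A ⟫
  ∈⟪⟫⁺ {A = A} {v} a = lookup⇒[]= v ⟪ A ⟫ (≡.trans (lookup∘tabulate _ v) does-yes)
    where
    does-yes : does (em {A v}) ≡ inside
    does-yes with em {A v}
    ... | yes _ = ≡.refl
    ... | no ¬a = contradiction a ¬a

  ∈⟪⟫⁻ : ∀ {m} {A : Pred (Fin m) 0ℓ} {v} → v ∈ˢ ⟪ A ⟫ → A v
  ∈⟪⟫⁻ {A = A} {v} v∈ with em {A v} | ≡.trans (≡.sym (lookup∘tabulate _ v)) ([]=⇒lookup v∈)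
  ... | yes a | _ = a
  ... | no _  | ()

  interval-nonempty : ∀ v → ∃ (Interval v)
  interval-nonempty v with em {∃ (Interval v)}
  ... | yes ∃x = ∃x
  ... | no ∄x = contradiction
      (trans (sym ℙ-∅) (trans (prob-cong ((λ ()) , λ {x} x∈I → ∄x (x , x∈I)) ∅-measurable)
          (proj₁ (minimal-support v))))
      0≉1
    where
    open FiniteProbability em ℝ (dist v) using (ℙ-∅)
    open MeasurableSets em ℝ (Probability.borel ℝ) using (∅-measurable)
    open Probability.ProbabilityMeasure (dist v) using (prob-cong)

  interval-resp-≈ : ∀ v {x y} → x ≈ y → Interval v x → Interval v y
  interval-resp-≈ v x≈y (l<x , x<r) = <-respʳ-≈ x≈y l<x , <-respˡ-≈ x≈y x<r

  IsCover : Subset n → Set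
  IsCover Q = ∀ {u v} → u ~ v → u ∈ˢ Q ⊎ v ∈ˢ Q

  -- The concrete form of being mandatory: a finite union of events, each about a single weight, and
  -- therefore measurable.
  Conflict : (Fin n → Carrier) → Fin n → Set
  Conflict w v = ∃ λ u → u ~ v × Interval v (w u)

  ~⇒≢ : ∀ {u v} → u ~ v → u ≢ v
  ~⇒≢ u~v ≡.refl = irrefl u~v

  Interval-set : ∀ {w Q w′ v y} → Consistent I w Q w′ → v ∉ˢ Q → Interval v y →
                 Consistent I w Q (updateAt w′ v (const y))
  Interval-set {w} {Q} {w′} {v} {y} consistent v∉Q y∈I x with x ≟ v
  ... | yes ≡.refl = (λ v∈Q → contradiction v∈Q v∉Q) ,
                     λ _ → ≡.subst (Interval v) (≡.sym (updateAt-updates v w′)) y∈I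
  ... | no x≢v = ≡.subst (λ z → (x ∈ˢ Q → z ≈ w x) × (x ∉ˢ Q → Interval x z))
                   (≡.sym (updateAt-minimal x v w′ x≢v)) (consistent x)

  -- If the weight of `u` lay inside the open interval of `v`, the unqueried weight of `v` could be
  -- moved strictly to either side of it, refuting both possible answers. Since `u` itself may be
  -- unqueried, this serves for covering edges as well as for mandatory vertices.
  unqueried-separated : ∀ {w Q} → IsFeasibleQuerySet I w Q → ∀ {u v} → u ~ v → v ∉ˢ Q →
                        ∀ {w′} → Consistent I w Q w′ → ¬ Interval v (w′ u)
  unqueried-separated {w} {Q} feasible {u} {v} u~v v∉Q {w′} consistent (l<w′u , w′u<r) =
    [ above-all (<-dense l<w′u) , below-all (<-dense w′u<r) ]′ (feasible u~v)
    where
    at : ∀ y → Interval v y → (R : Carrier → Carrier → Set) →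
         (∀ w″ → Consistent I w Q w″ → R (w″ u) (w″ v)) → R (w′ u) y
    at y y∈I R ordered = ≡.subst₂ R (updateAt-minimal u v w′ (~⇒≢ u~v)) (updateAt-updates v w′)
      (ordered _ (Interval-set consistent v∉Q y∈I))
    above-all : ∃ (λ y → left v < y × y < w′ u) → ¬ (∀ w″ → Consistent I w Q w″ → w″ u ≤ w″ v)
    above-all (y , l<y , y<w′u) u≤v = <⇒≱ y<w′u (at y (l<y , <-trans y<w′u w′u<r) _≤_ u≤v)
    below-all : ∃ (λ z → w′ u < z × z < right v) → ¬ (∀ w″ → Consistent I w Q w″ → w″ v ≤ w″ u)
    below-all (z , w′u<z , z<r) v≤u = <⇒≱ w′u<z (at z (<-trans l<w′u w′u<z , z<r) (λ a b → b ≤ a) v≤u)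

  some-consistent : ∀ w Q → ∃ (Consistent I w Q)
  some-consistent w Q = w₀ , consistent
    where
    w₀ : Fin n → Carrier
    w₀ v with v ∈ˢ? Q
    ... | yes _ = w v
    ... | no  _ = proj₁ (interval-nonempty v)
    consistent : Consistent I w Q w₀
    consistent v with v ∈ˢ? Q
    ... | yes v∈Q = (λ _ → reflexive ≡.refl) , contradiction v∈Q
    ... | no  v∉Q = (λ v∈Q → contradiction v∈Q v∉Q) , λ _ → proj₂ (interval-nonempty v)

  feasible⇒cover : ∀ {w Q} → IsFeasibleQuerySet I w Q → IsCover Q
  feasible⇒cover {w} {Q} feasible {u} {v} u~v with u ∈ˢ? Q | v ∈ˢ? Q
  ... | yes u∈Q | _       = inj₁ u∈Q
  ... | no _    | yes v∈Q = inj₂ v∈Q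
  -- With both endpoints unqueried, the weight of `u` can be placed at a common point of the two
  -- intervals.
  ... | no u∉Q  | no v∉Q with w′ , consistent ← some-consistent w Q | z , z∈Iu , z∈Iv ← intersecting u~v =
    contradiction (≡.subst (Interval v) (≡.sym (updateAt-updates u w′)) z∈Iv)
      (unqueried-separated feasible u~v v∉Q (Interval-set consistent u∉Q z∈Iu))

  half-queried-comparable : ∀ {w Q u v} → ¬ Conflict w v → u ~ v → u ∈ˢ Q → v ∉ˢ Q →
    (∀ w′ → Consistent I w Q w′ → w′ u ≤ w′ v) ⊎ (∀ w′ → Consistent I w Q w′ → w′ v ≤ w′ u)
  half-queried-comparable {w} {Q} {u} {v} ¬conflict u~v u∈Q v∉Q with em {w u ≤ left v} | em {right v ≤ w u}
  ... | yes wu≤l | _ = inj₁ λ w′ c →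
    ≤-trans (≤-reflexive (proj₁ (c u) u∈Q)) (≤-trans wu≤l (proj₁ (proj₁ (proj₂ (c v) v∉Q))))
  ... | no _ | yes r≤wu = inj₂ λ w′ c →
    ≤-trans (proj₁ (proj₂ (proj₂ (c v) v∉Q))) (≤-trans r≤wu (≤-reflexive (sym (proj₁ (c u) u∈Q))))
  ... | no wu≰l | no r≰wu = contradiction (u , u~v , ≰⇒> wu≰l , ≰⇒> r≰wu) ¬conflict

  cover⇒feasible : ∀ {w Q} → IsCover Q → (∀ {v} → Conflict w v → v ∈ˢ Q) → IsFeasibleQuerySet I w Q
  cover⇒feasible {w} {Q} cover conflicts⊆Q {u} {v} u~v with u ∈ˢ? Q | v ∈ˢ? Q
  ... | no u∉Q  | no v∉Q  = contradiction (cover u~v) [ u∉Q , v∉Q ]′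
  ... | yes u∈Q | no v∉Q  = half-queried-comparable (λ c → v∉Q (conflicts⊆Q c)) u~v u∈Q v∉Q
  ... | no u∉Q  | yes v∈Q = swap (half-queried-comparable (λ c → u∉Q (conflicts⊆Q c)) (symm u~v) v∈Q u∉Q)
  ... | yes u∈Q | yes v∈Q with total (w u) (w v)
  ...   | inj₁ wu≤wv = inj₁ λ w′ c →
    ≤-respˡ-≈ (sym (proj₁ (c u) u∈Q)) (≤-respʳ-≈ (sym (proj₁ (c v) v∈Q)) wu≤wv)
  ...   | inj₂ wv≤wu = inj₂ λ w′ c →
    ≤-respˡ-≈ (sym (proj₁ (c v) v∈Q)) (≤-respʳ-≈ (sym (proj₁ (c u) u∈Q)) wv≤wu)

  -- Without a conflict at `v`, querying all other vertices is feasible: it is a cover because there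
  -- are no loops, and it contains every vertex that has a conflict.
  mandatory⇒conflict : ∀ {w v} → IsMandatory I w v → Conflict w v
  mandatory⇒conflict {w} {v} mandatory with em {Conflict w v}
  ... | yes conflict = conflict
  ... | no ¬conflict = contradiction (mandatory (∁ ⁅ v ⁆) (cover⇒feasible cover λ {u} conflict →
          others λ { ≡.refl → ¬conflict conflict })) λ v∈∁v → x∈∁p⇒x∉p v∈∁v (x∈⁅x⁆ v)
    where
    others : ∀ {u} → u ≢ v → u ∈ˢ ∁ ⁅ v ⁆
    others u≢v = x∉p⇒x∈∁p (u≢v ∘ x∈⁅y⁆⇒x≡y v)
    cover : IsCover (∁ ⁅ v ⁆)
    cover {x} {y} x~y with x ≟ v
    ... | yes ≡.refl = inj₂ (others (~⇒≢ (symm x~y)))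
    ... | no x≢v = inj₁ (others x≢v)

  conflict⇒mandatory : ∀ {w v} → Conflict w v → IsMandatory I w v
  conflict⇒mandatory {w} {v} (u , u~v , wu∈I) Q feasible with v ∈ˢ? Q
  ... | yes v∈Q = v∈Q
  ... | no v∉Q with w′ , consistent ← some-consistent w Q | feasible⇒cover feasible u~v
  ...   | inj₂ v∈Q = v∈Q
  ...   | inj₁ u∈Q = contradiction (interval-resp-≈ v (sym (proj₁ (consistent u) u∈Q)) wu∈I)
                       (unqueried-separated feasible u~v v∉Q consistent)

  optimal-feasible : ∀ w → IsFeasibleQuerySet I w (optimalQuerySet I w)
  optimal-feasible w = argmin-all (weight cost) {P = IsFeasibleQuerySet I w}
    -- The default `⊤` competes in the `argmin`, so its feasibility is owed as well.
    (cover⇒feasible (λ _ → inj₁ ∈⊤) (λ _ → ∈⊤))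
    (All.tabulate λ {Q} Q∈ → proj₂ (∈-filter⁻ (λ Q → em {IsFeasibleQuerySet I w Q}) {xs = subsets n} Q∈))

  mandatorySet : (Fin n → Carrier) → Subset n
  mandatorySet w = ⟪ IsMandatory I w ⟫

  -- Same enumeration, weight and default as in `optimalQuerySet`, so that ties are broken alike and
  -- the results agree as sets, not only in cost.
  optimalCover : Subset n → Subset n
  optimalCover M = argmin (weight cost) ⊤ (filter (λ Q → em {IsCover Q × M ⊆ˢ Q}) (subsets n))

  -- Hence the measurability of OPT reduces to that of the mandatory-vertex events.
  optimal≡optimalCover : ∀ w → optimalQuerySet I w ≡ optimalCover (mandatorySet w)
  optimal≡optimalCover w = ≡.cong (argmin (weight cost) ⊤) (filter-≐
    (λ Q → em {IsFeasibleQuerySet I w Q}) (λ Q → em {IsCover Q × mandatorySet w ⊆ˢ Q})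
    (to , from) (subsets n))
    where
    to : ∀ {Q} → IsFeasibleQuerySet I w Q → IsCover Q × mandatorySet w ⊆ˢ Q
    to {Q} feasible = feasible⇒cover {w} {Q} feasible , λ v∈M → ∈⟪⟫⁻ v∈M Q feasible
    from : ∀ {Q} → IsCover Q × mandatorySet w ⊆ˢ Q → IsFeasibleQuerySet I w Q
    from (cover , M⊆Q) = cover⇒feasible cover λ conflict → M⊆Q (∈⟪⟫⁺ (conflict⇒mandatory conflict))

-- Marginal probabilities of the optimal query set.

module MarginalProbabilities (em : ExcludedMiddle 0ℓ) (ℝ : RealField)
                             {n} (I : GraphOrientation.Instance em ℝ n)
                             (W : GraphOrientation.RandomWeights em ℝ I) where
  open RealField ℝ
  open OrderedField ℝ
  open GraphOrientation em ℝ
  open GraphOrientation.Instance I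
  open RandomWeights W
  open QuerySets em ℝ I
  open BorelSets em ℝ using (interval-measurable)
  open MeasurableSets em ℝ space
  open FiniteProbability em ℝ measure hiding (ℙ)
  open Probability.ProbabilityMeasure measure using (prob-nonneg)
  open CommutativeRing commutativeRing using (sym)

  OPT : Ω → Subset n
  OPT ω = optimalQuerySet I (realization ω)

  mandatory-measurable : ∀ v → Measurable (λ ω → IsMandatory I (realization ω) v)
  mandatory-measurable v = resp (conflict⇒mandatory , mandatory⇒conflict)
    (∃-measurable λ u → ×-measurable (u ~ v) (measurable u (interval-measurable (left v) (right v))))

  OPT-discrete : Discrete OPT
  OPT-discrete P = resp
    ((λ {ω} → ≡.subst P (≡.sym (optimal≡optimalCover (realization ω)))) ,
     (λ {ω} → ≡.subst P (optimal≡optimalCover (realization ω))))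
    (⟪⟫-measurable mandatory-measurable (P ∘ optimalCover))

  optProb : Fin n → Carrier
  optProb v = ℙ (λ ω → v ∈ˢ OPT ω)

  0≤optProb : ∀ v → 0# ≤ optProb v
  0≤optProb v = prob-nonneg (OPT-discrete (v ∈ˢ_))

  mandatoryProb≤optProb : ∀ v → mandatoryProb v ≤ optProb v
  mandatoryProb≤optProb v = ℙ-mono (mandatory-measurable v) (OPT-discrete (v ∈ˢ_))
    λ {ω} mandatory → mandatory (OPT ω) (optimal-feasible (realization ω))

  OPT-cover : ∀ ω → IsCover (OPT ω)
  OPT-cover ω = feasible⇒cover {realization ω} (optimal-feasible (realization ω))

  edge-optProb : ∀ {u v} → u ~ v → 1# ≤ optProb u + optProb v
  edge-optProb {u} {v} u~v = ≤-respˡ-≈ (ℙ-certain λ ω → OPT-cover ω u~v)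
    (ℙ-∪-≤ (OPT-discrete (u ∈ˢ_)) (OPT-discrete (v ∈ˢ_)))

  𝔼[OPT]≈ : 𝔼[OPT] ≈ sum (λ v → cost v * optProb v)
  𝔼[OPT]≈ = expected-weight OPT-discrete cost

module Conditionals (ℝ : RealField) where
  open RealField ℝ

  if-∈ : ∀ {n} {S : Subset n} {v} {a b : Carrier} → v ∈ˢ S → (if does (v ∈ˢ? S) then a else b) ≡ a
  if-∈ {S = S} {v} v∈S with v ∈ˢ? S
  ... | yes _   = ≡.refl
  ... | no  v∉S = contradiction v∈S v∉S

  if-∉ : ∀ {n} {S : Subset n} {v} {a b : Carrier} → v ∉ˢ S → (if does (v ∈ˢ? S) then a else b) ≡ b
  if-∉ {S = S} {v} v∉S with v ∈ˢ? S
  ... | yes v∈S = contradiction v∈S v∉S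
  ... | no  _   = ≡.refl

-- The test vector for the LP, one edge at a time.

module TestSolution (em : ExcludedMiddle 0ℓ) (ℝ : RealField) (d : RealField.Carrier ℝ)
                    (0<d : RealField._<_ ℝ (RealField.0# ℝ) d) (d≤1 : RealField._≤_ ℝ d (RealField.1# ℝ)) where
  open RealField ℝ
  open OrderedField ℝ
  open HalfIntegrality em ℝ using (HalfIntegral)
  open CommutativeRing commutativeRing
    using (refl; sym; trans; +-cong; +-identityʳ; +-identityˡ)
  open IntegerCoefficients commutativeRing

  ½≉1 : ¬ ½ ≈ 1#
  ½≉1 = proj₂ ½<1

  ½≉0 : ¬ ½ ≈ 0#
  ½≉0 = 0<⇒≉0 0<½

  -- Twice the value at a vertex with LP value x that is mandatory with
  -- probability p and in OPT with probability q.
  test : (x q p : Carrier) → Carrier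
  test x q p with em {x ≈ 1#} | em {x ≈ ½}
  ... | yes _ | _     = 1# + (1# + d) * q
  ... | no  _ | yes _ = (1# - d) + 2# * d * q
  ... | no  _ | no  _ = (1# + d) * q - p

  test-1 : ∀ {x q p} → x ≈ 1# → test x q p ≈ 1# + (1# + d) * q
  test-1 {x} x≈1 with em {x ≈ 1#} | em {x ≈ ½}
  ... | yes _ | _ = refl
  ... | no x≉1 | _ = contradiction x≈1 x≉1

  test-½ : ∀ {x q p} → x ≈ ½ → test x q p ≈ (1# - d) + 2# * d * q
  test-½ {x} x≈½ with em {x ≈ 1#} | em {x ≈ ½}
  ... | yes x≈1 | _ = contradiction (trans (sym x≈½) x≈1) ½≉1
  ... | no _ | yes _ = refl
  ... | no _ | no x≉½ = contradiction x≈½ x≉½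

  test-0 : ∀ {x q p} → x ≈ 0# → test x q p ≈ (1# + d) * q - p
  test-0 {x} x≈0 with em {x ≈ 1#} | em {x ≈ ½}
  ... | yes x≈1 | _ = contradiction (trans (sym x≈0) x≈1) 0≉1
  ... | no _ | yes x≈½ = contradiction (trans (sym x≈½) x≈0) ½≉0
  ... | no _ | no _ = refl

  private
    0≤d = proj₁ 0<d
    0≤1-d = x≤y⇒0≤y-x d≤1
    0≤1+d = +-nonneg 0≤1 0≤d

  test-nonneg : ∀ {x q p} → HalfIntegral x → 0# ≤ q → p ≤ q → 0# ≤ test x q p
  test-nonneg {x} {q} {p} (inj₁ x≈0) 0≤q p≤q = ≤-respʳ-≈ (sym (test-0 x≈0))
    (≤-respʳ-≈ (solve 3 (λ d q p → (q :- p) :+ d :* q := (:1 :+ d) :* q :- p) refl d q p)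
      (+-nonneg (x≤y⇒0≤y-x p≤q) (*-nonneg 0≤d 0≤q)))
  test-nonneg (inj₂ (inj₁ x≈½)) 0≤q p≤q = ≤-respʳ-≈ (sym (test-½ x≈½))
    (+-nonneg 0≤1-d (*-nonneg (*-nonneg (proj₁ 0<2) 0≤d) 0≤q))
  test-nonneg (inj₂ (inj₂ x≈1)) 0≤q p≤q = ≤-respʳ-≈ (sym (test-1 x≈1))
    (+-nonneg 0≤1 (*-nonneg 0≤1+d 0≤q))

  -- Half-integrality and x + x′ ≥ 1 leave only the edges 1-1, 1-½, 1-0 and ½-½. The tightest is
  -- 1-0: there (1 + d)(q + q′) exceeds 1 by at least d, which absorbs the subtracted p′ ≤ d.
  test-edge : ∀ {x x′ q q′ p p′} → HalfIntegral x → HalfIntegral x′ → 1# ≤ x + x′ →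
              0# ≤ q → 0# ≤ q′ → p ≤ d → p′ ≤ d → 1# ≤ q + q′ → 2# ≤ test x q p + test x′ q′ p′
  test-edge {x} {x′} {q} {q′} {p} {p′} hx hx′ 1≤x+x′ 0≤q 0≤q′ p≤d p′≤d 1≤q+q′ = cases hx hx′
    where
    Q = q + q′ - 1#
    0≤Q : 0# ≤ Q
    0≤Q = x≤y⇒0≤y-x 1≤q+q′
    swapped : test x′ q′ p′ + test x q p ≈ test x q p + test x′ q′ p′
    swapped = solve 2 (λ a b → a :+ b := b :+ a) refl (test x′ q′ p′) (test x q p)
    too-small : ∀ {y y′} → x ≈ y → x′ ≈ y′ → y + y′ < 1# → 2# ≤ test x q p + test x′ q′ p′
    too-small x≈y x′≈y′ y+y′<1 = contradiction (≤-respʳ-≈ (+-cong x≈y x′≈y′) 1≤x+x′) (<⇒≱ y+y′<1)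
    1-½ : ∀ {q q′} → 0# ≤ q → 0# ≤ q′ → 0# ≤ q + q′ - 1# →
          2# ≤ (1# + (1# + d) * q) + ((1# - d) + 2# * d * q′)
    1-½ {q} {q′} 0≤q 0≤q′ 0≤Q = ≤-by (d * (q + q′ - 1#) + q + d * q′)
      (+-nonneg (+-nonneg (*-nonneg 0≤d 0≤Q) 0≤q) (*-nonneg 0≤d 0≤q′))
      (solve 3 (λ d q q′ → (:1 :+ :1) :+ (d :* (q :+ q′ :- :1) :+ q :+ d :* q′) :=
                 (:1 :+ (:1 :+ d) :* q) :+ ((:1 :- d) :+ (:1 :+ :1) :* d :* q′)) refl d q q′)
    1-0 : ∀ {q q′ p′} → p′ ≤ d → 0# ≤ q + q′ - 1# → 2# ≤ (1# + (1# + d) * q) + ((1# + d) * q′ - p′)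
    1-0 {q} {q′} {p′} p′≤d 0≤Q = ≤-by ((1# + d) * (q + q′ - 1#) + (d - p′))
      (+-nonneg (*-nonneg 0≤1+d 0≤Q) (x≤y⇒0≤y-x p′≤d))
      (solve 4 (λ d q q′ p′ → (:1 :+ :1) :+ ((:1 :+ d) :* (q :+ q′ :- :1) :+ (d :- p′)) :=
                 (:1 :+ (:1 :+ d) :* q) :+ ((:1 :+ d) :* q′ :- p′)) refl d q q′ p′)
    0≤Q˘ : 0# ≤ q′ + q - 1#
    0≤Q˘ = ≤-respʳ-≈ (solve 2 (λ q q′ → q :+ q′ :- :1 := q′ :+ q :- :1) refl q q′) 0≤Q
    cases : HalfIntegral x → HalfIntegral x′ → 2# ≤ test x q p + test x′ q′ p′
    cases (inj₁ x≈0) (inj₁ x′≈0) = too-small x≈0 x′≈0 (<-respˡ-≈ (sym (+-identityʳ 0#)) 0<1)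
    cases (inj₁ x≈0) (inj₂ (inj₁ x′≈½)) = too-small x≈0 x′≈½ (<-respˡ-≈ (sym (+-identityˡ ½)) ½<1)
    cases (inj₂ (inj₁ x≈½)) (inj₁ x′≈0) = too-small x≈½ x′≈0 (<-respˡ-≈ (sym (+-identityʳ ½)) ½<1)
    cases (inj₁ x≈0) (inj₂ (inj₂ x′≈1)) =
      ≤-respʳ-≈ (trans (sym (+-cong (test-1 x′≈1) (test-0 x≈0))) swapped) (1-0 p≤d 0≤Q˘)
    cases (inj₂ (inj₁ x≈½)) (inj₂ (inj₂ x′≈1)) =
      ≤-respʳ-≈ (trans (sym (+-cong (test-1 x′≈1) (test-½ x≈½))) swapped) (1-½ 0≤q′ 0≤q 0≤Q˘)
    cases (inj₂ (inj₂ x≈1)) (inj₁ x′≈0) =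
      ≤-respʳ-≈ (sym (+-cong (test-1 x≈1) (test-0 x′≈0))) (1-0 p′≤d 0≤Q)
    cases (inj₂ (inj₂ x≈1)) (inj₂ (inj₁ x′≈½)) =
      ≤-respʳ-≈ (sym (+-cong (test-1 x≈1) (test-½ x′≈½))) (1-½ 0≤q 0≤q′ 0≤Q)
    cases (inj₂ (inj₁ x≈½)) (inj₂ (inj₁ x′≈½)) =
      ≤-respʳ-≈ (sym (+-cong (test-½ x≈½) (test-½ x′≈½)))
        (≤-by (2# * (d * Q)) (*-nonneg (proj₁ 0<2) (*-nonneg 0≤d 0≤Q))
          (solve 3 (λ d q q′ → (:1 :+ :1) :+ (:1 :+ :1) :* (d :* (q :+ q′ :- :1)) :=
            (:1 :- d) :+ (:1 :+ :1) :* d :* q :+ ((:1 :- d) :+ (:1 :+ :1) :* d :* q′)) refl d q q′))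
    cases (inj₂ (inj₂ x≈1)) (inj₂ (inj₂ x′≈1)) =
      ≤-respʳ-≈ (sym (+-cong (test-1 x≈1) (test-1 x′≈1)))
        (≤-by ((1# + d) * q + (1# + d) * q′) (+-nonneg (*-nonneg 0≤1+d 0≤q) (*-nonneg 0≤1+d 0≤q′))
          (solve 3 (λ d q q′ → (:1 :+ :1) :+ ((:1 :+ d) :* q :+ (:1 :+ d) :* q′) :=
            (:1 :+ (:1 :+ d) :* q) :+ (:1 :+ (:1 :+ d) :* q′)) refl d q q′))

-- Comparison of Threshold with OPT, vertex by vertex.

module Competitive (em : ExcludedMiddle 0ℓ) (ℝ : RealField)
                   {n} (I : GraphOrientation.Instance em ℝ n)
                   (W : GraphOrientation.RandomWeights em ℝ I)
                   (α d : RealField.Carrier ℝ) (R : GraphOrientation.ThresholdRun em ℝ I W α d) where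
  open RealField ℝ
  open OrderedField ℝ
  open GraphOrientation em ℝ
  open GraphOrientation.Instance I
  open RandomWeights W
  open ThresholdRun R
  open QuerySets em ℝ I
  open MarginalProbabilities em ℝ I W
  open HalfIntegrality em ℝ
  open LinearAlgebra em ℝ
  open Conditionals ℝ
  open MeasurableSets em ℝ space
  open FiniteProbability em ℝ measure hiding (ℙ)
  open Probability.ProbabilityMeasure measure using (prob-nonneg; prob-cong)
  open CommutativeRing commutativeRing
    using (refl; sym; trans; reflexive; +-cong; +-congˡ; +-congʳ; *-congˡ; *-congʳ; -‿cong; +-identityˡ;
        +-identityʳ; *-identityʳ; *-assoc; zeroˡ; zeroʳ; semiring)
  open SemiringSum semiring using (sum-cong-≋; *-distribˡ-sum)
  open IntegerCoefficients commutativeRing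
  private
    module LP = VertexCoverLP graph cost (∁ M)

  queried-discrete : Discrete queried
  queried-discrete P = ⟪⟫-measurable (λ v → ×-measurable (v ∉ˢ Q) (mandatory-measurable v))
      (λ S → P (Q ∪ S))

  queryProb : Fin n → Carrier
  queryProb v = ℙ (λ ω → v ∈ˢ queried ω)

  𝔼[Threshold]≈ : 𝔼[Threshold] ≈ sum (λ v → cost v * queryProb v)
  𝔼[Threshold]≈ = expected-weight queried-discrete cost

  queryProb-∈ : ∀ {v} → v ∈ˢ Q → queryProb v ≈ 1#
  queryProb-∈ v∈Q = ℙ-certain λ ω → x∈p∪q⁺ (inj₁ v∈Q)

  queryProb-∉ : ∀ {v} → v ∉ˢ Q → queryProb v ≈ mandatoryProb v
  queryProb-∉ {v} v∉Q = prob-cong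
    ((λ v∈ → [ (λ v∈Q → contradiction v∈Q v∉Q) , proj₂ ∘ ∈⟪⟫⁻ ]′ (x∈p∪q⁻ _ _ v∈)) ,
     λ mandatory → x∈p∪q⁺ (inj₂ (∈⟪⟫⁺ (v∉Q , mandatory))))
    (queried-discrete (v ∈ˢ_))

  mandatoryProb≤d : ∀ {v} → v ∉ˢ M → mandatoryProb v ≤ d
  mandatoryProb≤d v∉M = proj₁ (≰⇒> (v∉M ∘ ∈⟪⟫⁺))

  x*-half-integral : ∀ {v} → v ∉ˢ M → HalfIntegral (x* v)
  x*-half-integral v∉M = basic⇒half-integral graph cost (∁ M) (proj₁ (proj₂ x*-optimal)) (x∉p⇒x∈∁p v∉M)

  -- With these costs, `expected-weight` computes the expected cost of the part of OPT inside `V½`.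
  cost½ : Fin n → Carrier
  cost½ v = if does (v ∈ˢ? V½) then cost v else 0#

  weight-V½∩ : ∀ S → weight cost (V½ ∩ S) ≈ weight cost½ S
  weight-V½∩ S = sum-cong-≋ pointwise
    where
    pointwise : ∀ v → (if does (v ∈ˢ? (V½ ∩ S)) then cost v else 0#) ≈
        (if does (v ∈ˢ? S) then cost½ v else 0#)
    pointwise v with v ∈ˢ? V½ | v ∈ˢ? S
    ... | yes v∈V½ | yes v∈S = reflexive (if-∈ (x∈p∩q⁺ (v∈V½ , v∈S)))
    ... | no v∉V½  | yes _   = reflexive (if-∉ (v∉V½ ∘ proj₁ ∘ x∈p∩q⁻ _ _))
    ... | _        | no v∉S  = reflexive (if-∉ (v∉S ∘ proj₂ ∘ x∈p∩q⁻ V½ S))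

  -- Every value taken by OPT cuts out a vertex cover of `V½`, to which the approximation guarantee
  -- applies; the guarantees are then averaged with the distribution of OPT.
  VC′-bound : weight cost VC′ ≤ α * sum (λ v → cost½ v * optProb v)
  VC′-bound = ≤-respˡ-≈ total-mass (≤-respʳ-≈ average (sum-mono pointwise))
    where
    S : Fin (length (subsets n)) → Subset n
    S = lookup (subsets n)
    P : Fin (length (subsets n)) → Carrier
    P i = ℙ (λ ω → OPT ω ≡ S i)
    total-mass : sum (λ i → weight cost VC′ * P i) ≈ weight cost VC′
    total-mass = trans (sym (*-distribˡ-sum (weight cost VC′) P)) (trans (*-congˡ
      (trans (sum-cong-≋ (λ i → prob-cong ((_, _) , proj₁) (OPT-discrete (_≡ S i))))
        (trans (ℙ-marginal OPT-discrete U.U) (ℙ-certain λ _ → _)))) (*-identityʳ _))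
    average : sum (λ i → α * (weight cost½ (S i) * P i)) ≈ α * sum (λ v → cost½ v * optProb v)
    average = trans (sym (*-distribˡ-sum α (λ i → weight cost½ (S i) * P i)))
        (*-congˡ (expected-weight OPT-discrete cost½))
    pointwise : ∀ i → weight cost VC′ * P i ≤ α * (weight cost½ (S i) * P i)
    pointwise i with em {∃ λ ω → OPT ω ≡ S i}
    ... | yes (ω , OPT≡S) = ≤-respʳ-≈ (*-assoc _ _ _) (*-monoʳ-≤ (prob-nonneg (OPT-discrete (_≡ S i)))
      (≤-respʳ-≈ (*-congˡ (weight-V½∩ (S i))) (VC′-approx (V½ ∩ S i) (p∩q⊆p V½ (S i) , λ {u} {v} u∈ v∈ u~v →
        Sum.map (λ u∈O → x∈p∩q⁺ (u∈ , ≡.subst (u ∈ˢ_) OPT≡S u∈O))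
            (λ v∈O → x∈p∩q⁺ (v∈ , ≡.subst (v ∈ˢ_) OPT≡S v∈O))
          (OPT-cover ω u~v)))))
    -- A subset that OPT never equals need not be a cover, but its weight in the average is zero.
    ... | no ∄ω = ≤-reflexive (trans (*-congˡ P≈0)
        (trans (zeroʳ _) (sym (trans (*-congˡ (trans (*-congˡ P≈0) (zeroʳ _))) (zeroʳ _)))))
      where
      P≈0 : P i ≈ 0#
      P≈0 = trans (prob-cong ((λ {ω} eq → ∄ω (ω , eq)) , λ ()) (OPT-discrete (_≡ S i))) ℙ-∅

  -- The ratio enters only through these two lower bounds on `ρ`, so both the maximum and the
  -- balanced parameter are instances.
  module _ (0<d : 0# < d) (d≤1 : d ≤ 1#) (1≤α : 1# ≤ α) {ρ : Carrier} (1≤ρd : 1# ≤ ρ * d)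
           (bound≤ρ : α + (2# - α) * d ≤ ρ) where
    open TestSolution em ℝ d 0<d d≤1

    z y : Fin n → Carrier
    z v = test (x* v) (optProb v) (mandatoryProb v)
    y v = ½ * z v

    y+y≈z : ∀ v → y v + y v ≈ z v
    y+y≈z v = trans (solve 2 (λ h z → h :* z :+ h :* z := (h :+ h) :* z) refl ½ (z v))
      (trans (*-congʳ ½+½≈1) (solve 1 (λ z → :1 :* z := z) refl (z v)))

    y-feasible : LP.Feasible y
    y-feasible (LP.edge {u} {v} u∈ v∈ u~v) =
      ≤-respʳ-≈ (solve 3 (λ h a b → h :* (a :+ b) := h :* a :+ h :* b) refl ½ (z u) (z v))
      (≤-respˡ-≈ (trans (solve 1 (λ h → h :* (:1 :+ :1) := h :+ h) refl ½) ½+½≈1)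
        (*-monoˡ-≤ (proj₁ 0<½) (test-edge (x*-half-integral u∉M) (x*-half-integral v∉M)
          (proj₁ x*-optimal (LP.edge u∈ v∈ u~v)) (0≤optProb u) (0≤optProb v)
          (mandatoryProb≤d u∉M) (mandatoryProb≤d v∉M) (edge-optProb u~v))))
      where
      u∉M = x∈∁p⇒x∉p u∈
      v∉M = x∈∁p⇒x∉p v∈
    y-feasible (LP.nonneg {v} v∈) = *-nonneg (proj₁ 0<½)
      (test-nonneg (x*-half-integral (x∈∁p⇒x∉p v∈)) (0≤optProb v) (mandatoryProb≤optProb v))

    private
      β γ : Carrier
      β = α + (2# - α) * d
      γ = 1# - d
      OPTᵥ Xᵥ Yᵥ Cᵥ Dᵥ total-bound : Fin n → Carrier
      OPTᵥ v = cost v * optProb v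
      Xᵥ v = if does (v ∈ˢ? ∁ M) then cost v * x* v else 0#
      Yᵥ v = if does (v ∈ˢ? ∁ M) then cost v * y v else 0#
      Cᵥ v = if does (v ∈ˢ? VC′) then cost v else 0#
      Dᵥ v = cost½ v * optProb v

      -- The sum to be bounded is ρ · OPT plus two nonpositive terms: twice the objective gap
      -- between the LP optimum and `y`, and γ times the slack of `VC′-bound`. Doubling clears the
      -- halves in `y`.
      combine : (o x x′ c e : Carrier) → Carrier
      combine o x x′ c e = ρ * o + 2# * x + - 2# * x′ + γ * c + - (γ * α) * e

      total-bound v = combine (OPTᵥ v) (Xᵥ v) (Yᵥ v) (Cᵥ v) (Dᵥ v)

      0≤γ : 0# ≤ γ
      0≤γ = x≤y⇒0≤y-x d≤1

      0≤ρ-β : 0# ≤ ρ - β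
      0≤ρ-β = x≤y⇒0≤y-x bound≤ρ

      0≤ρ : 0# ≤ ρ
      0≤ρ = *-cancelˡ-nonneg 0<d (≤-respʳ-≈ (solve 2 (λ r d → r :* d := d :* r) refl ρ d)
          (≤-trans 0≤1 1≤ρd))

      sum-total : sum total-bound ≈ combine (sum OPTᵥ) (sum Xᵥ) (sum Yᵥ) (sum Cᵥ) (sum Dᵥ)
      sum-total =
        trans (sum-linear (- (γ * α)) (λ v → ρ * OPTᵥ v + 2# * Xᵥ v + - 2# * Yᵥ v + γ * Cᵥ v) Dᵥ) (+-congʳ
        (trans (sum-linear γ (λ v → ρ * OPTᵥ v + 2# * Xᵥ v + - 2# * Yᵥ v) Cᵥ) (+-congʳ
        (trans (sum-linear (- 2#) (λ v → ρ * OPTᵥ v + 2# * Xᵥ v) Yᵥ) (+-congʳ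
        (trans (sum-linear 2# (λ v → ρ * OPTᵥ v) Xᵥ) (+-congʳ
        (sym (*-distribˡ-sum ρ OPTᵥ)))))))))

      combine-≤ : combine (sum OPTᵥ) (sum Xᵥ) (sum Yᵥ) (sum Cᵥ) (sum Dᵥ) ≤ ρ * sum OPTᵥ
      combine-≤ = ≤-by (2# * (sum Yᵥ - sum Xᵥ) + γ * (α * sum Dᵥ - sum Cᵥ))
        (+-nonneg (*-nonneg (proj₁ 0<2) (x≤y⇒0≤y-x (proj₂ (proj₂ x*-optimal) y y-feasible)))
                  (*-nonneg 0≤γ (x≤y⇒0≤y-x VC′-bound)))
        (solve 9 (λ r t g a o x x′ c e →
            r :* o :+ t :* x :+ :- t :* x′ :+ g :* c :+ :- (g :* a) :* e
              :+ (t :* (x′ :- x) :+ g :* (a :* e :- c)) := r :* o)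
          refl ρ 2# γ α (sum OPTᵥ) (sum Xᵥ) (sum Yᵥ) (sum Cᵥ) (sum Dᵥ))

      -- X and Y are given by their doubles, which are free of halves.
      assemble : ∀ {v r XX YY C D} →
        queryProb v ≈ r → Xᵥ v + Xᵥ v ≈ XX → Yᵥ v + Yᵥ v ≈ YY → Cᵥ v ≈ C → Dᵥ v ≈ D →
        cost v * r ≤ ρ * (cost v * optProb v) + XX - YY + γ * C - γ * α * D →
        cost v * queryProb v ≤ total-bound v
      assemble {v} r≈ XX≈ YY≈ C≈ D≈ le = ≤-respˡ-≈ (*-congˡ (sym r≈)) (≤-respʳ-≈ (sym (trans
        (solve 8 (λ o x x′ g c a e r →
            r :* o :+ (:1 :+ :1) :* x :+ :- (:1 :+ :1) :* x′ :+ g :* c :+ :- (g :* a) :* e :=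
            r :* o :+ (x :+ x) :- (x′ :+ x′) :+ g :* c :- g :* a :* e) refl
          (OPTᵥ v) (Xᵥ v) (Yᵥ v) γ (Cᵥ v) α (Dᵥ v) ρ)
        (+-cong (+-cong (+-cong (+-congˡ XX≈) (-‿cong YY≈)) (*-congˡ C≈)) (-‿cong (*-congˡ D≈))))) le)

      pointwise : ∀ v → cost v * queryProb v ≤ total-bound v
      pointwise v with v ∈ˢ? M
      ... | yes v∈M = assemble {v} (queryProb-∈ (x∈p∪q⁺ (inj₁ v∈M)))
          (trans (+-cong X≈0 X≈0) (+-identityˡ 0#)) (trans (+-cong Y≈0 Y≈0) (+-identityˡ 0#))
              (reflexive (if-∉ v∉VC′))
          (trans (*-congʳ (reflexive (if-∉ v∉V½))) (zeroˡ _))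
          -- On `M` only OPT pays: ρq ≥ ρp ≥ ρd ≥ 1.
          (≤-by (c * (ρ * q - 1#)) (*-nonneg (cost-nonneg v)
              (x≤y⇒0≤y-x (≤-trans 1≤ρd (*-monoˡ-≤ 0≤ρ (≤-trans (∈⟪⟫⁻ v∈M) (mandatoryProb≤optProb v))))))
            (solve 5 (λ c r q g a →
               c :* :1 :+ c :* (r :* q :- :1) :=
               r :* (c :* q) :+ :0 :- :0 :+ g :* :0 :- g :* a :* :0) refl c ρ q γ α))
        where
        c = cost v
        q = optProb v
        v∉∁M : v ∉ˢ ∁ M
        v∉∁M v∈∁M = x∈∁p⇒x∉p v∈∁M v∈M
        v∉V½ : v ∉ˢ V½
        v∉V½ v∈V½ = proj₁ (∈⟪⟫⁻ v∈V½) v∈M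
        v∉VC′ : v ∉ˢ VC′
        v∉VC′ = v∉V½ ∘ proj₁ VC′-cover
        X≈0 : Xᵥ v ≈ 0#
        X≈0 = reflexive (if-∉ v∉∁M)
        Y≈0 : Yᵥ v ≈ 0#
        Y≈0 = reflexive (if-∉ v∉∁M)
      ... | no v∉M = by-value (x*-half-integral v∉M)
        where
        c = cost v
        q = optProb v
        p = mandatoryProb v
        0≤cq : 0# ≤ c * q
        0≤cq = *-nonneg (cost-nonneg v) (0≤optProb v)
        X+X : ∀ {a b} → x* v ≈ a → a + a ≈ b → Xᵥ v + Xᵥ v ≈ c * b
        X+X {a} x≈a a+a≈b = trans (+-cong X≈ X≈)
            (trans (solve 2 (λ c a → c :* a :+ c :* a := c :* (a :+ a)) refl c a) (*-congˡ a+a≈b))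
          where
          X≈ : Xᵥ v ≈ c * a
          X≈ = trans (reflexive (if-∈ (x∉p⇒x∈∁p v∉M))) (*-congˡ x≈a)
        Y+Y : ∀ {b} → z v ≈ b → Yᵥ v + Yᵥ v ≈ c * b
        Y+Y z≈b = trans (+-cong Y≈ Y≈) (trans
            (solve 2 (λ c a → c :* a :+ c :* a := c :* (a :+ a)) refl c (y v))
            (*-congˡ (trans (y+y≈z v) z≈b)))
          where
          Y≈ : Yᵥ v ≈ c * y v
          Y≈ = reflexive (if-∈ (x∉p⇒x∈∁p v∉M))
        not-V½ : ∀ {a} → x* v ≈ a → ¬ ½ ≈ a → v ∉ˢ V½
        not-V½ x≈a ½≉a v∈V½ = ½≉a (trans (sym (proj₂ (∈⟪⟫⁻ v∈V½))) x≈a)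
        not-V₁ : ∀ {a} → x* v ≈ a → ¬ a ≈ 1# → v ∉ˢ V₁
        not-V₁ x≈a a≉1 v∈V₁ = a≉1 (trans (sym x≈a) (proj₂ (∈⟪⟫⁻ v∈V₁)))
        unqueried : v ∉ˢ V₁ → v ∉ˢ VC′ → queryProb v ≈ p
        unqueried v∉V₁ v∉VC′ = queryProb-∉ λ v∈Q → [ v∉M , [ v∉V₁ , v∉VC′ ]′ ∘ x∈p∪q⁻ _ _ ]′
            (x∈p∪q⁻ _ _ v∈Q)
        C≈0 : v ∉ˢ VC′ → Cᵥ v ≈ 0#
        C≈0 v∉VC′ = reflexive (if-∉ v∉VC′)
        D≈0 : v ∉ˢ V½ → Dᵥ v ≈ 0#
        D≈0 v∉V½ = trans (*-congʳ (reflexive (if-∉ v∉V½))) (zeroˡ _)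
        D≈cq : x* v ≈ ½ → Dᵥ v ≈ c * q
        D≈cq x≈½ = *-congʳ (reflexive (if-∈ {S = V½} {v} (∈⟪⟫⁺ (v∉M , x≈½))))
        -- This expression is ρ - (1 + d), because β - (1 + d) = (α - 1)(1 - d).
        0≤ρ-[1+d] : 0# ≤ (ρ - β) + (α - 1#) * γ
        0≤ρ-[1+d] = +-nonneg 0≤ρ-β (*-nonneg (x≤y⇒0≤y-x 1≤α) 0≤γ)

        by-value : HalfIntegral (x* v) → c * queryProb v ≤ total-bound v
        -- On `V₀` the -p of the test vector turns into +cp in the combination and pays for a later
        -- mandatory query.
        by-value (inj₁ x≈0) = assemble {v} (unqueried (not-V₁ x≈0 0≉1) v∉VC′)
            (X+X x≈0 (+-identityʳ 0#)) (Y+Y (test-0 x≈0)) (C≈0 v∉VC′) (D≈0 v∉V½)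
            (≤-by (c * q * ((ρ - β) + (α - 1#) * γ)) (*-nonneg 0≤cq 0≤ρ-[1+d])
              (solve 6 (λ c q p d r a →
                 c :* p :+ c :* q :* ((r :- (a :+ ((:1 :+ :1) :- a) :* d)) :+ (a :- :1) :* (:1 :- d)) :=
                 r :* (c :* q) :+ c :* :0 :- c :* ((:1 :+ d) :* q :- p)
                   :+ (:1 :- d) :* :0 :- (:1 :- d) :* a :* :0)
                refl c q p d ρ α))
          where
          v∉V½ = not-V½ x≈0 ½≉0
          v∉VC′ : v ∉ˢ VC′
          v∉VC′ = v∉V½ ∘ proj₁ VC′-cover
        -- On `V₁` the LP gap is 2c - c - (1 + d)cq; it supplies the full cost c, and ρ ≥ 1 + d
        -- covers the rest.
        by-value (inj₂ (inj₂ x≈1)) = assemble {v}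
            (queryProb-∈ (x∈p∪q⁺ (inj₂ (x∈p∪q⁺ (inj₁ (∈⟪⟫⁺ (v∉M , x≈1)))))))
            (X+X x≈1 refl) (Y+Y (test-1 x≈1)) (C≈0 (v∉V½ ∘ proj₁ VC′-cover)) (D≈0 v∉V½)
            (≤-by (c * q * ((ρ - β) + (α - 1#) * γ)) (*-nonneg 0≤cq 0≤ρ-[1+d])
              (solve 5 (λ c q d r a →
                 c :* :1 :+ c :* q :* ((r :- (a :+ ((:1 :+ :1) :- a) :* d)) :+ (a :- :1) :* (:1 :- d)) :=
                 r :* (c :* q) :+ c :* (:1 :+ :1) :- c :* (:1 :+ (:1 :+ d) :* q)
                   :+ (:1 :- d) :* :0 :- (:1 :- d) :* a :* :0)
                refl c q d ρ α))
          where v∉V½ = not-V½ x≈1 ½≉1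
        by-value (inj₂ (inj₁ x≈½)) = [ in-cover , outside-cover ]′ (toSum (v ∈ˢ? VC′))
          where
          -- The LP gap supplies cd and the cover bound the missing c(1 - d); the terms in q total
          -- exactly β.
          in-cover : v ∈ˢ VC′ → c * queryProb v ≤ total-bound v
          in-cover v∈VC′ = assemble {v} (queryProb-∈ (x∈p∪q⁺ (inj₂ (x∈p∪q⁺ (inj₂ v∈VC′)))))
            (X+X x≈½ ½+½≈1) (Y+Y (test-½ x≈½)) (reflexive (if-∈ v∈VC′)) (D≈cq x≈½)
            (≤-by (c * q * (ρ - β)) (*-nonneg 0≤cq 0≤ρ-β)
              (solve 5 (λ c q d r a →
                 c :* :1 :+ c :* q :* (r :- (a :+ ((:1 :+ :1) :- a) :* d)) :=
                 r :* (c :* q) :+ c :* :1 :- c :* ((:1 :- d) :+ (:1 :+ :1) :* d :* q)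
                   :+ (:1 :- d) :* c :- (:1 :- d) :* a :* (c :* q))
                refl c q d ρ α))
          -- Here only cd is supplied, which suffices since the vertex is queried with probability p
          -- ≤ d.
          outside-cover : v ∉ˢ VC′ → c * queryProb v ≤ total-bound v
          outside-cover v∉VC′ = assemble {v} (unqueried (not-V₁ x≈½ ½≉1) v∉VC′)
            (X+X x≈½ ½+½≈1) (Y+Y (test-½ x≈½)) (C≈0 v∉VC′) (D≈cq x≈½)
            (≤-by (c * (d - p) + c * q * (ρ - β))
                (+-nonneg (*-nonneg (cost-nonneg v) (x≤y⇒0≤y-x (mandatoryProb≤d v∉M)))
                (*-nonneg 0≤cq 0≤ρ-β))
              (solve 6 (λ c q p d r a →
                 c :* p :+ (c :* (d :- p) :+ c :* q :* (r :- (a :+ ((:1 :+ :1) :- a) :* d))) :=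
                 r :* (c :* q) :+ c :* :1 :- c :* ((:1 :- d) :+ (:1 :+ :1) :* d :* q)
                   :+ (:1 :- d) :* :0 :- (:1 :- d) :* a :* (c :* q))
                refl c q p d ρ α))

    threshold-bound : 𝔼[Threshold] ≤ ρ * 𝔼[OPT]
    threshold-bound = ≤-respˡ-≈ (sym 𝔼[Threshold]≈) (≤-respʳ-≈ (*-congˡ (sym 𝔼[OPT]≈))
      (≤-trans (sum-mono pointwise) (≤-respˡ-≈ (sym sum-total) combine-≤)))

-- The parameter that balances the two bounds.

theorem3p1 : (em : ExcludedMiddle 0ℓ) (ℝ : RealField) →
    let open RealField ℝ
        open GraphOrientation em ℝ
    in (α : Carrier) → 1# ≤ α → α ≤ 2# →
       ((d : Carrier) → 0# < d → d ≤ 1# →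
          ThresholdCompetitive α d (d ⁻¹ ⊔ (α + (2# - α) * d)))
       × (Σ[ s ∈ Carrier ] (IsSqrt (8# - α * (4# - α)) s ×
            (let d = 2# * (α + s) ⁻¹ in
             0# < d × d ≤ 1# × ThresholdCompetitive α d (½ * (α + s)))))
theorem3p1 em ℝ α 1≤α α≤2 =
  (λ d 0<d d≤1 I W R → Competitive.threshold-bound em ℝ I W α d R 0<d d≤1 1≤α
    (≤-respˡ-≈ (*-inverseʳ (0<⇒≉0 0<d)) (≤-respˡ-≈ (*-comm _ d) (*-monoʳ-≤ (proj₁ 0<d) (x≤x⊔y (d ⁻¹) _))))
    (x≤y⊔x (d ⁻¹) _)) ,
  s , s-sqrt , 0<D , D≤1 , λ I W R → Competitive.threshold-bound em ℝ I W α D R 0<D D≤1 1≤α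
    (≤-reflexive (sym ρD≈1)) β≤ρ
  where
  open RealField ℝ
  open OrderedField ℝ
  open Classical em ℝ using (sqrt)
  open CommutativeRing commutativeRing
    using (refl; sym; trans; +-congˡ; *-comm; *-congˡ; *-congʳ)
  open IntegerCoefficients commutativeRing
  open import Algebra.Construct.NaturalChoice.Max totalOrder using (x≤x⊔y; x≤y⊔x)
  open ≈-Reasoning
  -- The radicand is 4 + (2 - α)², hence nonnegative, and its root is at least 2; the latter gives
  -- `D≤1`.
  root : Σ[ s ∈ Carrier ] IsSqrt (8# - α * (4# - α)) s
  root = sqrt _ (≤-respʳ-≈
    (solve 1 (λ a → let :2 = :1 :+ :1 ; :4 = :2 :+ :2 in
       :4 :+ (:2 :- a) :* (:2 :- a) := (:4 :+ :4) :- a :* (:4 :- a)) refl α)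
    (+-nonneg (+-nonneg (proj₁ 0<2) (proj₁ 0<2)) (0≤x*x (2# - α))))
  s = proj₁ root
  s-sqrt = proj₂ root
  s² = proj₂ s-sqrt
  0≤s : 0# ≤ s
  0≤s = proj₁ s-sqrt
  2≤s : 2# ≤ s
  2≤s = square-cancel-≤ (<-respʳ-≈ (solve 2 (λ x y → x :+ y := y :+ x) refl 2# s) (+-pos-nonneg 0<2 0≤s))
    (≤-respʳ-≈ (sym s²) (≤-by ((2# - α) * (2# - α)) (0≤x*x (2# - α))
      (solve 1 (λ a → let :2 = :1 :+ :1 ; :4 = :2 :+ :2 in
         :2 :* :2 :+ (:2 :- a) :* (:2 :- a) := (:4 :+ :4) :- a :* (:4 :- a)) refl α)))
  k D : Carrier
  k = α + s
  -- The positive solution of 1/d = α + (2 - α)d, at which both bounds equal k/2.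
  D = 2# * k ⁻¹
  0<k : 0# < k
  0<k = +-pos-nonneg (<-≤-trans 0<1 1≤α) 0≤s
  0<D : 0# < D
  0<D = *-pos 0<2 (⁻¹-pos 0<k)
  kD≈2 : k * D ≈ 2#
  kD≈2 = begin
    k * (2# * k ⁻¹)   ≈⟨ solve 2 (λ k i → k :* ((:1 :+ :1) :* i) := (:1 :+ :1) :* (k :* i)) refl k (k ⁻¹) ⟩
    2# * (k * k ⁻¹)   ≈⟨ *-congˡ (*-inverseʳ (0<⇒≉0 0<k)) ⟩
    2# * 1#           ≈⟨ solve 0 ((:1 :+ :1) :* :1 := :1 :+ :1) refl ⟩
    2#                ∎
  D≤1 : D ≤ 1#
  D≤1 = *-cancelˡ-≤ 0<k (≤-respˡ-≈ (sym kD≈2) (≤-by (α + (s - 2#))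
    (+-nonneg (≤-trans 0≤1 1≤α) (x≤y⇒0≤y-x 2≤s))
    (solve 2 (λ a s → (:1 :+ :1) :+ (a :+ (s :- (:1 :+ :1))) := (a :+ s) :* :1) refl α s)))
  ρD≈1 : ½ * k * D ≈ 1#
  ρD≈1 = begin
    ½ * k * D     ≈⟨ solve 3 (λ h k d → h :* k :* d := h :* (k :* d)) refl ½ k D ⟩
    ½ * (k * D)   ≈⟨ *-congˡ kD≈2 ⟩
    ½ * 2#        ≈⟨ trans (solve 1 (λ h → h :* (:1 :+ :1) := h :+ h) refl ½) ½+½≈1 ⟩
    1#            ∎
  -- In fact an equality: multiplied by 2k, and with kD = 2 and the value of s², both sides become
  -- k².
  β≤ρ : α + (2# - α) * D ≤ ½ * k
  β≤ρ = *-cancelˡ-≤ (*-pos 0<2 0<k) (≤-reflexive (begin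
    2# * k * (α + (2# - α) * D)
      ≈⟨ solve 3 (λ k a d → let :2 = :1 :+ :1 in
           :2 :* k :* (a :+ (:2 :- a) :* d) := :2 :* k :* a :+ :2 :* (:2 :- a) :* (k :* d)) refl k α D ⟩
    2# * k * α + 2# * (2# - α) * (k * D)      ≈⟨ +-congˡ (*-congˡ kD≈2) ⟩
    2# * k * α + 2# * (2# - α) * 2#
      ≈⟨ solve 2 (λ a s → let :2 = :1 :+ :1 ; :4 = :2 :+ :2 in
           :2 :* (a :+ s) :* a :+ :2 :* (:2 :- a) :* :2 :=
           a :* a :+ :2 :* a :* s :+ ((:4 :+ :4) :- a :* (:4 :- a))) refl α s ⟩
    α * α + 2# * α * s + (8# - α * (4# - α))  ≈⟨ +-congˡ s² ⟨
    α * α + 2# * α * s + s * s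
      ≈⟨ solve 2 (λ a s → a :* a :+ (:1 :+ :1) :* a :* s :+ s :* s := (a :+ s) :* (a :+ s)) refl α s ⟩
    k * k
      ≈⟨ trans (*-congʳ ½+½≈1) (solve 1 (λ x → :1 :* x := x) refl (k * k)) ⟨
    (½ + ½) * (k * k)
      ≈⟨ solve 2 (λ h k → (h :+ h) :* (k :* k) := (:1 :+ :1) :* k :* (h :* k)) refl ½ k ⟩
    2# * k * (½ * k)            ∎))
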